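{- Let $G=(V,E)$ be a finite strongly connected simple directed graph with the property that $\mathbb{P}(L(u,v)) = \mathbb{P}(L(u,w))$ for any three distinct vertices $u,v,w\in V$ (that is, a random cover tour starting at any vertex is equally likely to end at any other vertex). Then $G$ is either a cycle with all edges bidirected or a complete graph with all edges bidirected.
   Context: A simple directed graph (digraph) has no loops and at most one edge from $u$ to $v$ for each ordered pair of distinct vertices $(u,v)$; both $uv$ and $vu$ may be edges, where $uv$ denotes the edge directed from $u$ to $v$. A cycle (respectively complete graph) with all edges bidirected is the digraph obtained from an undirected cycle on at least $3$ vertices (respectively an undirected complete graph on at least $1$ vertex) by replacing each undirected edge $\{u,v\}$ with the two directed edges $uv$ and $vu$. The random walk on $G$ moves at each step from its current vertex to an out-neighbor of that vertex chosen uniformly at random, independently of the past. A random cover tour from $u$ is this random walk started at $u$ (the starting vertex $u$ counts as visited) and stopped at the first time it has visited every vertex of $G$; in a finite strongly connected digraph it terminates almost surely. $L(u,v)$ denotes the event that the random cover tour from $u$ ends at $v$, i.e. that $v$ is the last vertex to be visited for the first time. -}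

module Defs where

open import Level using (0ℓ)
open import Data.Nat as ℕ using (ℕ; zero; suc; NonZero)
open import Data.Nat.DivMod using (_%_)
open import Data.Integer using (+_)
open import Data.Rational as ℚ using (ℚ; 0ℚ; 1ℚ)
open import Data.Fin using (Fin; toℕ; _≤_; _<_)
open import Data.Fin.Properties using (_≟_; _≤?_; _<?_; any?; all?)
open import Data.Fin.Permutation using (Permutation′; _⟨$⟩ʳ_)
open import Data.List using (List; []; _∷_; map; filter; foldr; length; allFin)
open import Data.Vec using (Vec; []; _∷_; lookup)
open import Data.Product using (∃; _×_)
open import Data.Sum using (_⊎_)
open import Data.Bool using (if_then_else_)
open import Function.Bundles using (_⇔_)
open import Relation.Binary using (Rel; Irreflexive) renaming (Decidable to Decidable₂)
open import Relation.Binary.PropositionalEquality using (_≡_; _≢_)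
open import Relation.Binary.Construct.Closure.ReflexiveTransitive using (Star)
open import Relation.Nullary using (¬_; does; ¬?)
open import Relation.Nullary.Decidable using (_×-dec_; _→-dec_)
open import Relation.Unary using (Pred; Decidable)

record SimpleDigraph (n : ℕ) : Set₁ where
  field
    Edge   : Rel (Fin n) 0ℓ
    edge?  : Decidable₂ Edge
    noLoop : Irreflexive _≡_ Edge

open SimpleDigraph public

private variable
  n k : ℕ

StronglyConnected : SimpleDigraph n → Set
StronglyConnected {n} G = (u v : Fin n) → Star (Edge G) u v

-- Edges are exactly the pairs of distinct vertices; bidirectedness is implicit
-- because _≢_ is symmetric.
IsBidirectedComplete : SimpleDigraph n → Set
IsBidirectedComplete {n} G = (u v : Fin n) → Edge G u v ⇔ u ≢ v

CyclicSuccessor : .{{_ : NonZero n}} → Rel (Fin n) 0ℓ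
CyclicSuccessor {n} i j = toℕ j ≡ suc (toℕ i) % n

-- The vertices are π 0, …, π (n - 1) in cyclic order.
IsBidirectedCycle : .{{_ : NonZero n}} → SimpleDigraph n → Set
IsBidirectedCycle {n} G =
  3 ℕ.≤ n ×
  ∃ λ (π : Permutation′ n) → (i j : Fin n) →
    Edge G (π ⟨$⟩ʳ i) (π ⟨$⟩ʳ j) ⇔ (CyclicSuccessor i j ⊎ CyclicSuccessor j i)

outNeighbours : SimpleDigraph n → Fin n → List (Fin n)
outNeighbours {n} G u = filter (edge? G u) (allFin n)

-- The empty list is only reached from a vertex without out-neighbours, which a
-- strongly connected digraph on at least two vertices does not have.
mean : List ℚ → ℚ
mean []          = 0ℚ
mean qs@(_ ∷ _) = foldr ℚ._+_ 0ℚ qs ℚ.* (+ 1 ℚ./ length qs)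

-- walkProb G u k A? is the probability that the first k steps X₁, …, X_k of the
-- random walk from X₀ = u satisfy A: condition on X₁, which is uniform on the
-- out-neighbours of u; by the Markov property X₂, …, X_k are then the first
-- k - 1 steps of a random walk from X₁.
walkProb : SimpleDigraph n → Fin n → (k : ℕ) →
           {A : Pred (Vec (Fin n) k) 0ℓ} → Decidable A → ℚ
walkProb G u zero    A? = if does (A? []) then 1ℚ else 0ℚ
walkProb G u (suc k) A? =
  mean (map (λ x → walkProb G x k (λ xs → A? (x ∷ xs))) (outNeighbours G u))

-- A trajectory Vec (Fin n) (suc k) lists X₀, …, X_k.

VisitedBy : Vec (Fin n) (suc k) → Fin (suc k) → Fin n → Set
VisitedBy X t w = ∃ λ s → s ≤ t × lookup X s ≡ w

CoveredBy : Vec (Fin n) (suc k) → Fin (suc k) → Set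
CoveredBy X t = ∀ w → VisitedBy X t w

IsCoverTime : Vec (Fin n) (suc k) → Fin (suc k) → Set
IsCoverTime X t = CoveredBy X t × (∀ s → s < t → ¬ CoveredBy X s)

TourEndsAt : Fin n → Vec (Fin n) (suc k) → Set
TourEndsAt v X = ∃ λ t → IsCoverTime X t × lookup X t ≡ v

coveredBy? : (X : Vec (Fin n) (suc k)) → Decidable (CoveredBy X)
coveredBy? X t = all? λ w → any? λ s → (s ≤? t) ×-dec (lookup X s ≟ w)

tourEndsAt? : (v : Fin n) → Decidable (TourEndsAt {k = k} v)
tourEndsAt? v X = any? λ t →
  (coveredBy? X t ×-dec (all? λ s → (s <? t) →-dec ¬? (coveredBy? X s)))
  ×-dec (lookup X t ≟ v)

-- L(u,v) is the increasing union over k of the events that the cover tour from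
-- u has ended at v within k steps, so ℙ(L(u,v)) is the limit of the
-- nondecreasing sequence, bounded by 1, of the probabilities of these events.
-- The real number ℙ(L(u,v)) is represented by this rational sequence.
ℙL : SimpleDigraph n → Fin n → Fin n → ℕ → ℚ
ℙL G u v k = walkProb G u k (λ xs → tourEndsAt? v (u ∷ xs))

-- Equality of the real numbers represented by two convergent rational sequences.
infix 4 _≈_
_≈_ : Rel (ℕ → ℚ) 0ℓ
a ≈ b = (ε : ℚ) → 0ℚ ℚ.< ε →
        ∃ λ N → ∀ k → N ℕ.≤ k → ℚ.∣ a k ℚ.- b k ∣ ℚ.< ε

{-# OPTIONS --safe #-}
module Submission where

-- Write c = 1/(n - 1). A first-step analysis at u gives, for u ≠ v, that ℙ(L(u,v)) is the average over the
-- out-neighbours x of u of ℙ(L(x,v)) + ℙ(D(x)), where D(x) is the event that the walk from x visits every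
-- vertex other than u and v, then v, and only then u; the term x = v contributes 0. All ℙ(L(u,v)) equal
-- c > 0, because the tour terminates almost surely. Hence
--   * some walk from u ends its tour at v, so every G − v is strongly connected;
--   * if uv is not an edge then ℙ(D(x)) = 0 for all x, which forces some two vertices of G − {u,v} to be
--     mutually unreachable;
--   * if uv is an edge then some ℙ(D(x)) > 0, so of any two vertices of G − {u,v} one reaches the other.
-- The condition on G − {u,v} is symmetric in u and v, so all edges are bidirected. If G is not complete, take
-- u, v nonadjacent and a, b in different components of G − {u,v}. Since G − {a,b} is disconnected while each
-- of its vertices still reaches u or v, it separates u from v. Applied to neighbours of u this shows that u
-- has no three neighbours, so G is 2-regular and connected.

open import Defs
open import Data.Nat as ℕ using (ℕ; zero; suc; NonZero; z≤n; s≤s)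
import Data.Nat.Properties as ℕ
open import Data.Nat.DivMod using (_%_; m%n<n; m<n⇒m%n≡m; n%n≡0)
open import Data.Integer as ℤ using ()
import Data.Integer.Properties as ℤ
open import Data.Rational as ℚ using (ℚ; 0ℚ; 1ℚ; mkℚ; toℚᵘ)
open import Data.Rational.Properties hiding (_≟_; _≤?_; _<?_)
import Data.Rational.Unnormalised as ℚᵘ
import Data.Rational.Unnormalised.Properties as ℚᵘ
open import Data.Rational.Solver using (module +-*-Solver)
open import Algebra.Properties.CommutativeMonoid.Sum +-0-commutativeMonoid
  using (sum; sum-cong-≗; sum-remove; sum-replicate-zero)
open import Data.Fin as Fin using (Fin; zero; suc; toℕ; fromℕ; fromℕ<; inject₁; punchIn; _↑ˡ_)
open import Data.Fin.Properties as Fin using (_≟_; any?; sequence; ¬∀⟶∃¬-smallest; punchInᵢ≢i; pigeonhole; injective⇒≤;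
  toℕ<n; toℕ-injective; toℕ-↑ˡ; toℕ-fromℕ<; toℕ-inject; toℕ-inject₁; fromℕ<-injective)
open import Data.Fin.Permutation using (permutation)
open import Data.List using (List; []; _∷_; map; foldr; filter; length; allFin)
open import Data.List.Properties using (length-map; map-cong)
open import Data.List.Membership.Propositional using (_∈_)
open import Data.List.Membership.Propositional.Properties using (∈-filter⁺; ∈-filter⁻; ∈-allFin)
open import Data.List.Relation.Unary.All using (All; []; _∷_; tabulate)
open import Data.List.Relation.Unary.Any using (here; there)
open import Data.List.Relation.Unary.Linked using (Linked; []; [-]; _∷_)
open import Data.Vec using (Vec; []; _∷_; _++_; lookup)
open import Data.Vec.Properties using (lookup-++ˡ)
open import Data.Product using (∃; ∃₂; _×_; _,_; proj₁; proj₂; swap)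
open import Data.Sum as Sum using (_⊎_; inj₁; inj₂)
open import Data.Bool using (if_then_else_)
open import Data.Unit using (⊤; tt)
open import Data.Empty using (⊥; ⊥-elim)
open import Effect.Monad using (RawMonad)
open import Function using (_∘_; const; id)
open import Function.Bundles using (mk⇔)
open import Level using (0ℓ)
open import Relation.Nullary using (¬_; Dec; yes; no; does; ¬?)
open import Relation.Nullary.Decidable using (_×-dec_; decidable-stable; ¬¬-excluded-middle)
open import Relation.Nullary.Negation using (¬¬-Monad)
open import Relation.Unary using (Pred; Decidable)
open import Relation.Binary using (Rel; tri<; tri≈; tri>)
open import Relation.Binary.PropositionalEquality
open import Relation.Binary.Construct.Closure.ReflexiveTransitive as Star using (Star; _◅_; _◅◅_)

-- Trajectories

module _ where

  open import Data.Fin using (_<_; _≤_)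

  private variable
    n k j : ℕ

  Off : Fin n → Fin n → Pred (Fin n) 0ℓ
  Off u v x = x ≢ u × x ≢ v

  off? : (u v : Fin n) → Decidable (Off u v)
  off? u v x = ¬? (x ≟ u) ×-dec ¬? (x ≟ v)

  -- When `P` excludes `v`, the time `t` is the first hitting time of `v`; this replaces the
  -- minimality clause of `IsCoverTime`.
  Visits : (P Q : Pred (Fin n) 0ℓ) → Fin n → Vec (Fin n) k → Set
  Visits P Q v X = ∃ λ t → lookup X t ≡ v × (∀ s → s < t → P (lookup X s)) ×
                           (∀ w → Q w → ∃ λ s → s < t × lookup X s ≡ w)

  -- Sweep v v says that the cover tour ends at v; Sweep u v is the event D above.
  Sweep : Fin n → Fin n → Vec (Fin n) k → Set
  Sweep u v = Visits (Off u v) (Off u v) v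

  Covers : Vec (Fin n) k → Set
  Covers X = ∀ w → ∃ λ s → lookup X s ≡ w

  -- If `v` had occurred before the cover time `t`, all vertices would be covered one step before
  -- `t` already, against minimality.
  endsAt⇒sweep : ∀ {v} (X : Vec (Fin n) (suc k)) → TourEndsAt v X → Sweep v v X
  endsAt⇒sweep {v = v} X (t , (covered , first) , Xt≡v) = t , Xt≡v , early , before
    where
    before : ∀ w → Off v v w → ∃ λ s → s < t × lookup X s ≡ w
    before w (w≢v , _) with covered w
    ... | s , s≤t , Xs≡w =
      s , ℕ.≤∧≢⇒< s≤t (λ eq → w≢v (trans (sym Xs≡w) (trans (cong (lookup X) (toℕ-injective eq)) Xt≡v))) , Xs≡w

    not-early : ∀ t → (∀ w → w ≢ v → ∃ λ s → s < t × lookup X s ≡ w) →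
                (∀ s → s < t → ¬ CoveredBy X s) → ∀ s → s < t → lookup X s ≢ v
    not-early (suc t) before first s (s≤s s≤t) Xs≡v = first (inject₁ t) (s≤s (ℕ.≤-reflexive (toℕ-inject₁ t))) visited
      where
      visited : CoveredBy X (inject₁ t)
      visited w with w ≟ v
      ... | yes refl = s , subst (toℕ s ℕ.≤_) (sym (toℕ-inject₁ t)) s≤t , Xs≡v
      ... | no w≢v with before w w≢v
      ...   | r , s≤s r≤t , Xr≡w = r , subst (toℕ r ℕ.≤_) (sym (toℕ-inject₁ t)) r≤t , Xr≡w

    early : ∀ s → s < t → Off v v (lookup X s)
    early s s<t = let ne = not-early t (λ w w≢v → before w (w≢v , w≢v)) first s s<t in ne , ne

  sweep⇒endsAt : ∀ {v} (X : Vec (Fin n) (suc k)) → Sweep v v X → TourEndsAt v X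
  sweep⇒endsAt {v = v} X (t , Xt≡v , early , before) = t , (covered , first) , Xt≡v
    where
    covered : CoveredBy X t
    covered w with w ≟ v
    ... | yes refl = t , ℕ.≤-refl , Xt≡v
    ... | no w≢v with before w (w≢v , w≢v)
    ...   | s , s<t , eq = s , ℕ.<⇒≤ s<t , eq

    first : ∀ s → s < t → ¬ CoveredBy X s
    first s s<t cov with cov v
    ... | r , r≤s , Xr≡v = proj₁ (early r (ℕ.≤-<-trans r≤s s<t)) Xr≡v

  -- If `v` and `w` differed, each of the two hitting times would come strictly before the other.
  sweep-unique : ∀ {v w} (X : Vec (Fin n) k) → Sweep v v X → Sweep w w X → v ≡ w
  sweep-unique {v = v} {w} X (t , Xt≡v , early , before) (t′ , Xt′≡w , early′ , before′) =
    decidable-stable (v ≟ w) λ v≢w →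
      let s , s<t , Xs≡w = before w (v≢w ∘ sym , v≢w ∘ sym)
          s′ , s′<t′ , Xs′≡v = before′ v (v≢w , v≢w)
          t′≤s = ℕ.≮⇒≥ (λ s<t′ → proj₁ (early′ s s<t′) Xs≡w)
          t≤s′ = ℕ.≮⇒≥ (λ s′<t → proj₁ (early s′ s′<t) Xs′≡v)
      in ℕ.<-irrefl refl (ℕ.<-≤-trans s<t (ℕ.≤-trans t≤s′ (ℕ.<⇒≤ (ℕ.<-≤-trans s′<t′ t′≤s))))

  -- This and the next three lemmas are the combinatorial form of first-step analysis: for `u ≢ v`,
  -- a tour `u ∷ X` ending at `v` is of exactly one of two kinds, according to whether `X` meets `u`
  -- again before `v`.
  sweep-∷ : ∀ {u v} (X : Vec (Fin n) k) → u ≢ v → Sweep v v X → Sweep v v (u ∷ X)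
  sweep-∷ {u = u} {v} X u≢v (t , Xt≡v , early , before) = suc t , Xt≡v , early′ , before′
    where
    early′ : ∀ s → s < suc t → Off v v (lookup (u ∷ X) s)
    early′ zero    _         = u≢v , u≢v
    early′ (suc s) (s≤s s<t) = early s s<t
    before′ : ∀ w → Off v v w → ∃ λ s → s < suc t × lookup (u ∷ X) s ≡ w
    before′ w off = let s , s<t , eq = before w off in suc s , s≤s s<t , eq

  sweep-detour : ∀ {u v} (X : Vec (Fin n) k) → u ≢ v → Sweep u v X → Sweep v v (u ∷ X)
  sweep-detour {u = u} {v} X u≢v (t , Xt≡v , early , before) = suc t , Xt≡v , early′ , before′
    where
    early′ : ∀ s → s < suc t → Off v v (lookup (u ∷ X) s)
    early′ zero    _         = u≢v , u≢v
    early′ (suc s) (s≤s s<t) = let ne = proj₂ (early s s<t) in ne , ne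
    before′ : ∀ w → Off v v w → ∃ λ s → s < suc t × lookup (u ∷ X) s ≡ w
    before′ w (w≢v , _) with w ≟ u
    ... | yes refl = zero , s≤s z≤n , refl
    ... | no w≢u = let s , s<t , eq = before w (w≢u , w≢v) in suc s , s≤s s<t , eq

  detour-excludes : ∀ {u v} (X : Vec (Fin n) k) → u ≢ v → Sweep u v X → ¬ Sweep v v X
  detour-excludes {u = u} {v} X u≢v (t , Xt≡v , early , _) (t′ , _ , early′ , before′) =
    let s , s<t′ , Xs≡u = before′ u (u≢v , u≢v)
        t≤s = ℕ.≮⇒≥ (λ s<t → proj₁ (early s s<t) Xs≡u)
    in proj₁ (early′ t (ℕ.≤-<-trans t≤s s<t′)) Xt≡v

  sweep-uncons : ∀ {u v} (X : Vec (Fin n) k) → u ≢ v → Sweep v v (u ∷ X) → Sweep v v X ⊎ Sweep u v X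
  sweep-uncons X u≢v (zero , u≡v , _) = ⊥-elim (u≢v u≡v)
  sweep-uncons {u = u} {v} X u≢v (suc t , Xt≡v , early , before)
    with Fin.any? (λ s → (s Fin.<? t) ×-dec (lookup X s ≟ u))
  ... | yes (s , s<t , Xs≡u) = inj₁ (t , Xt≡v , (λ r r<t → early (suc r) (s≤s r<t)) , before′)
    where
    before′ : ∀ w → Off v v w → ∃ λ s → s < t × lookup X s ≡ w
    before′ w off with before w off
    ... | zero , _ , refl = s , s<t , Xs≡u
    ... | suc r , s≤s r<t , eq = r , r<t , eq
  ... | no none = inj₂ (t , Xt≡v ,
    (λ r r<t → (λ Xr≡u → none (r , r<t , Xr≡u)) , proj₁ (early (suc r) (s≤s r<t))) , before′)
    where
    before′ : ∀ w → Off u v w → ∃ λ s → s < t × lookup X s ≡ w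
    before′ w (w≢u , w≢v) with before w (w≢v , w≢v)
    ... | zero , _ , u≡w = ⊥-elim (w≢u (sym u≡w))
    ... | suc r , s≤s r<t , eq = r , r<t , eq

  -- The event is decided at a time inside the prefix, so it persists under every continuation. A
  -- single finite walk thus contributes its weight at all later horizons.
  visits-++ : ∀ {P Q v} (X : Vec (Fin n) k) {Y : Vec (Fin n) j} → Visits P Q v X → Visits P Q v (X ++ Y)
  visits-++ {k = k} {j} {P} {Q} X {Y} (t , Xt≡v , early , before) =
    t ↑ˡ j , trans (lookup-++ˡ X Y t) Xt≡v , early′ , before′
    where
    early′ : ∀ s → s < t ↑ˡ j → P (lookup (X ++ Y) s)
    early′ s s<t = subst (P ∘ lookup (X ++ Y)) r≡s (subst P (sym (lookup-++ˡ X Y r)) (early r r<t))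
      where
      s<t′ : toℕ s ℕ.< toℕ t
      s<t′ = subst (toℕ s ℕ.<_) (toℕ-↑ˡ t j) s<t
      s<k : toℕ s ℕ.< k
      s<k = ℕ.<-trans s<t′ (Fin.toℕ<n t)
      r : Fin k
      r = fromℕ< s<k
      r<t : r < t
      r<t = subst (ℕ._< toℕ t) (sym (toℕ-fromℕ< s<k)) s<t′
      r≡s : r ↑ˡ j ≡ s
      r≡s = toℕ-injective (trans (toℕ-↑ˡ r j) (toℕ-fromℕ< s<k))
    before′ : ∀ w → Q w → ∃ λ s → s < t ↑ˡ j × lookup (X ++ Y) s ≡ w
    before′ w Qw = let s , s<t , eq = before w Qw in
      s ↑ˡ j , subst₂ ℕ._<_ (sym (toℕ-↑ˡ s j)) (sym (toℕ-↑ˡ t j)) s<t , trans (lookup-++ˡ X Y s) eq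

  covers-++ : (X : Vec (Fin n) k) {Y : Vec (Fin n) j} → Covers X → Covers (X ++ Y)
  covers-++ {j = j} X {Y} cov w = let s , eq = cov w in s ↑ˡ j , trans (lookup-++ˡ X Y s) eq

  sweep⇒covers : ∀ {v} (X : Vec (Fin n) k) → Sweep v v X → Covers X
  sweep⇒covers {v = v} X (t , Xt≡v , _ , before) w with w ≟ v
  ... | yes refl = t , Xt≡v
  ... | no w≢v = let s , _ , eq = before w (w≢v , w≢v) in s , eq

  covers⇒endsAt : (X : Vec (Fin n) (suc k)) → Covers X → ∃ λ v → TourEndsAt v X
  covers⇒endsAt {k = k} X cov =
    -- The search returns the least counterexample, so it is run on the negated predicate; its
    -- result is the cover time.
    let t , ¬¬cov , first = ¬∀⟶∃¬-smallest (suc k) (λ t → ¬ CoveredBy X t) (¬? ∘ coveredBy? X)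
          (λ never → never (fromℕ k) end)
    in lookup X t , t , (decidable-stable (coveredBy? X t) ¬¬cov ,
         λ s s<t → subst (λ s → ¬ CoveredBy X s)
           (toℕ-injective (trans (toℕ-inject (fromℕ< s<t)) (toℕ-fromℕ< s<t))) (first (fromℕ< s<t))) , refl
    where
    end : CoveredBy X (fromℕ k)
    end w = let s , eq = cov w in s , Fin.≤fromℕ s , eq

  covers? : (X : Vec (Fin n) k) → Dec (Covers X)
  covers? X = Fin.all? λ w → Fin.any? λ s → lookup X s ≟ w

  -- Walks that collect all vertices of a set

  module Tours {n : ℕ} (G : SimpleDigraph n) where

    Restrict : Pred (Fin n) 0ℓ → Rel (Fin n) 0ℓ
    Restrict P x y = Edge G x y × P x × P y

    Walk : Fin n → Vec (Fin n) k → Set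
    Walk u []       = ⊤
    Walk u (x ∷ xs) = Edge G u x × Walk x xs

    segment : ∀ {P} x (xs : Vec (Fin n) k) → Walk x xs → ∀ (t : Fin (suc k)) → (∀ s → s < t → P (lookup (x ∷ xs) s)) →
              ∀ r s → r ≤ s → s < t → Star (Restrict P) (lookup (x ∷ xs) r) (lookup (x ∷ xs) s)
    segment x xs w t early zero zero _ _ = Star.ε
    segment x (y ∷ xs) (e , w) (suc t) early zero (suc s) _ (s≤s s<t) =
      (e , early zero (s≤s z≤n) , early (suc zero) (s≤s (ℕ.≤-<-trans z≤n s<t))) ◅
      segment y xs w t (λ r r<t → early (suc r) (s≤s r<t)) zero s z≤n s<t
    segment x (y ∷ xs) (e , w) (suc t) early (suc r) (suc s) (s≤s r≤s) (s≤s s<t) =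
      segment y xs w t (λ r r<t → early (suc r) (s≤s r<t)) r s r≤s s<t

    -- A variant of `Visits` that can be built from its end backwards: the vertices collected form a
    -- list, which grows as the walk is prolonged at its front. The index `t` refers to `xs`, so `v`
    -- is hit at time `suc t` of `x ∷ xs`.
    Tour : Pred (Fin n) 0ℓ → Fin n → List (Fin n) → Fin n → Set
    Tour P v l x = ∃₂ λ k (xs : Vec (Fin n) k) → Walk x xs × ∃ λ t → lookup xs t ≡ v ×
      (∀ s → s < suc t → P (lookup (x ∷ xs) s)) × (∀ {w} → w ∈ l → ∃ λ s → s < suc t × lookup (x ∷ xs) s ≡ w)

    module _ {P : Pred (Fin n) 0ℓ} {v : Fin n} where

      tour-stop : ∀ {x} → P x → Edge G x v → Tour P v [] x
      tour-stop Px e = 1 , v ∷ [] , (e , tt) , zero , refl , (λ { zero _ → Px ; (suc _) (s≤s ()) }) , λ ()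

      tour-step : ∀ {x y l} → P x → Edge G x y → Tour P v l y → Tour P v l x
      tour-step {x} {y} Px e (k , xs , w , t , eq , early , visits) =
        suc k , y ∷ xs , (e , w) , suc t , eq ,
        (λ { zero _ → Px ; (suc s) (s≤s s<t) → early s s<t }) ,
        λ w∈l → let s , s<t , eq = visits w∈l in suc s , s≤s s<t , eq

      tour-mark : ∀ {x l} → Tour P v l x → Tour P v (x ∷ l) x
      tour-mark (k , xs , w , t , eq , early , visits) = k , xs , w , t , eq , early ,
        λ { (here refl) → zero , s≤s z≤n , refl ; (there w∈l) → visits w∈l }

      tour-star : ∀ {x y l} → Star (Restrict P) x y → Tour P v l y → Tour P v l x
      tour-star Star.ε              = id
      tour-star ((e , Px , _) ◅ st) = tour-step Px e ∘ tour-star st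

      tour-linked : (∀ z → P z → Tour P v [] z) → ∀ {s l} → All P (s ∷ l) → Linked (Star (Restrict P)) (s ∷ l) →
                    Tour P v (s ∷ l) s
      tour-linked exit (Ps ∷ [])  [-]       = tour-mark (exit _ Ps)
      tour-linked exit (Ps ∷ all) (st ∷ ch) = tour-mark (tour-star st (tour-linked exit all ch))

    module _ {R : Rel (Fin n) 0ℓ} {P : Pred (Fin n) 0ℓ} (total : ∀ a b → P a → P b → R a b ⊎ R b a) where

      -- With `sort`, this is the insertion argument showing that every tournament has a Hamiltonian
      -- path: `a` goes in front of the first later element `c` for which `total` yields `R a c`,
      -- and the head `b` stays in place.
      insert : ∀ a → P a → ∀ b l → All P (b ∷ l) → Linked R (b ∷ l) → R b a →
               ∃ λ l′ → Linked R (b ∷ l′) × All P l′ × a ∈ l′ × (∀ {w} → w ∈ l → w ∈ l′)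
      insert a Pa b [] _ _ b≤a = a ∷ [] , b≤a ∷ [-] , Pa ∷ [] , here refl , λ ()
      insert a Pa b (c ∷ l) (_ ∷ all@(Pc ∷ _)) (b≤c ∷ ch) b≤a with total a c Pa Pc
      ... | inj₁ a≤c = a ∷ c ∷ l , b≤a ∷ a≤c ∷ ch , Pa ∷ all , here refl , there
      ... | inj₂ c≤a = let l′ , ch′ , all′ , a∈ , sub = insert a Pa c l all ch c≤a in
        c ∷ l′ , b≤c ∷ ch′ , Pc ∷ all′ , there a∈ , λ { (here refl) → here refl ; (there w∈) → there (sub w∈) }

      sort : ∀ x l → All P (x ∷ l) → ∃₂ λ s l′ → Linked R (s ∷ l′) × All P (s ∷ l′) × (∀ {w} → w ∈ x ∷ l → w ∈ s ∷ l′)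
      sort x []      all = x , [] , [-] , all , id
      sort x (y ∷ l) (Px ∷ all) with sort y l all
      ... | s , l′ , ch , all′@(Ps ∷ _) , sub with total x s Px Ps
      ...   | inj₁ x≤s = x , s ∷ l′ , x≤s ∷ ch , Px ∷ all′ , λ { (here refl) → here refl ; (there w∈) → there (sub w∈) }
      ...   | inj₂ s≤x = let l″ , ch″ , all″ , x∈ , sub′ = insert x Px s l′ all′ ch s≤x in
        s , l″ , ch″ , Ps ∷ all″ , λ { (here refl) → there x∈ ; (there w∈) → keep sub′ (sub w∈) }
        where
        keep : ∀ {l″ w} → (∀ {w} → w ∈ l′ → w ∈ l″) → w ∈ s ∷ l′ → w ∈ s ∷ l″
        keep _    (here refl) = here refl
        keep sub′ (there w∈)  = there (sub′ w∈)

    -- Sort the vertices of `P` by reachability inside `P`, walk from each to the next, and leave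
    -- for `v` from the last. The start `s` is whichever vertex comes first, so it remains for the
    -- caller to reach it.
    exhaustive-tour : ∀ {P v x} → Decidable P → P x →
                      (∀ a b → P a → P b → Star (Restrict P) a b ⊎ Star (Restrict P) b a) →
                      (∀ z → P z → Tour P v [] z) →
                      ∃₂ λ s l → P s × (∀ {w} → P w → w ∈ l) × Tour P v l s
    exhaustive-tour {P} {v} {x} P? Px total exit
      with sort total x (filter P? (allFin n)) (Px ∷ tabulate (λ w∈ → proj₂ (∈-filter⁻ P? {xs = allFin n} w∈)))
    ... | s , l , ch , all@(Ps ∷ _) , sub =
      s , s ∷ l , Ps , (λ {w} Pw → sub (there (∈-filter⁺ P? (∈-allFin w) Pw))) , tour-linked exit all ch

    tour⇒visits : ∀ {P v l x} → (∀ {w} → P w → w ∈ l) → Tour P v l x →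
                  ∃₂ λ k (xs : Vec (Fin n) k) → Walk x xs × Visits P P v (x ∷ xs)
    tour⇒visits all∈ (k , xs , w , t , eq , early , visits) =
      k , xs , w , suc t , eq , early , λ z Pz → visits (all∈ Pz)

-- Expectations over random walks

module _ where

  open import Data.Rational using (_+_; _*_; _≤_; _<_; -_)
  open +-*-Solver using (solve; _:=_; _:+_; _:*_; :-_; con)

  private variable
    A B : Set
    p q r x y δ : ℚ

  -- The equation says `q - p = y - x`; it reduces a linear inequality to an identity for the ring
  -- solver.
  linear : x ≤ y → p + y ≡ q + x → p ≤ q
  linear {x} {y} {p} {q} x≤y eq = begin
    p              ≡⟨ solve 2 (λ p y → p := (p :+ y) :+ :- y) refl p y ⟩
    p + y + - y    ≡⟨ cong (_+ - y) eq ⟩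
    q + x + - y    ≤⟨ +-monoˡ-≤ (- y) (+-monoʳ-≤ q x≤y) ⟩
    q + y + - y    ≡⟨ solve 2 (λ q y → (q :+ y) :+ :- y := q) refl q y ⟩
    q              ∎
    where open ≤-Reasoning

  *-monoˡ : 0ℚ ≤ r → p ≤ q → r * p ≤ r * q
  *-monoˡ {r} 0≤r p≤q = *-monoˡ-≤-nonNeg r {{ℚ.nonNegative 0≤r}} p≤q

  *-monoʳ : 0ℚ ≤ r → p ≤ q → p * r ≤ q * r
  *-monoʳ {r} 0≤r p≤q = *-monoʳ-≤-nonNeg r {{ℚ.nonNegative 0≤r}} p≤q

  *-pos : 0ℚ < p → 0ℚ < q → 0ℚ < p * q
  *-pos {p} {q} 0<p 0<q =
    positive⁻¹ (p * q) {{pos*pos⇒pos p {{ℚ.positive 0<p}} q {{ℚ.positive 0<q}}}}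

  halve : 0ℚ < p → ∃ λ q → 0ℚ < q × q + q ≡ p
  halve {p} 0<p = p * ℚ.½ , *-pos 0<p (positive⁻¹ ℚ.½) ,
    trans (sym (*-distribˡ-+ p ℚ.½ ℚ.½)) (*-identityʳ p)

  ℕ→ℚ : ℕ → ℚ
  ℕ→ℚ k = ℤ.+ k ℚ./ 1

  ℕ→ℚ-suc : ∀ k → ℕ→ℚ (suc k) ≡ 1ℚ + ℕ→ℚ k
  ℕ→ℚ-suc k = toℚᵘ-injective (begin
    toℚᵘ (ℕ→ℚ (suc k))                     ≈⟨ toℚᵘ-fromℚᵘ (ℚᵘ.mkℚᵘ (ℤ.+ suc k) 0) ⟩
    ℚᵘ.mkℚᵘ (ℤ.+ suc k) 0                      ≈⟨ ℚᵘ.*≡*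
      (cong (λ z → (ℤ.+ 1 ℤ.+ z) ℤ.* ℤ.+ 1) (sym (ℤ.*-identityʳ (ℤ.+ k)))) ⟩
    ℚᵘ.1ℚᵘ ℚᵘ.+ ℚᵘ.mkℚᵘ (ℤ.+ k) 0              ≈⟨ ℚᵘ.+-congʳ ℚᵘ.1ℚᵘ (ℚᵘ.≃-sym (toℚᵘ-fromℚᵘ (ℚᵘ.mkℚᵘ (ℤ.+ k) 0))) ⟩
    toℚᵘ 1ℚ ℚᵘ.+ toℚᵘ (ℕ→ℚ k)              ≈⟨ ℚᵘ.≃-sym (toℚᵘ-homo-+ 1ℚ (ℕ→ℚ k)) ⟩
    toℚᵘ (1ℚ + ℕ→ℚ k)                      ∎)
    where open ℚᵘ.≃-Reasoning

  ℕ→ℚ-inverse : ∀ k → ℕ→ℚ (suc k) * (ℤ.+ 1 ℚ./ suc k) ≡ 1ℚ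
  ℕ→ℚ-inverse k = toℚᵘ-injective (begin
    toℚᵘ (ℕ→ℚ (suc k) * (ℤ.+ 1 ℚ./ suc k))            ≈⟨ toℚᵘ-homo-* (ℕ→ℚ (suc k)) (ℤ.+ 1 ℚ./ suc k) ⟩
    toℚᵘ (ℕ→ℚ (suc k)) ℚᵘ.* toℚᵘ (ℤ.+ 1 ℚ./ suc k)    ≈⟨ ℚᵘ.*-cong
      (toℚᵘ-fromℚᵘ (ℚᵘ.mkℚᵘ (ℤ.+ suc k) 0)) (toℚᵘ-fromℚᵘ (ℚᵘ.mkℚᵘ (ℤ.+ 1) k)) ⟩
    ℚᵘ.mkℚᵘ (ℤ.+ suc k) 0 ℚᵘ.* ℚᵘ.mkℚᵘ (ℤ.+ 1) k          ≈⟨ ℚᵘ.*-inverseʳ (ℚᵘ.mkℚᵘ (ℤ.+ suc k) 0) ⟩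
    ℚᵘ.1ℚᵘ ∎)
    where open ℚᵘ.≃-Reasoning

  -- For `p = a / b` with `a ≥ 1` the denominator `b` works, since `b * p = a`.
  archimedean : ∀ p → 0ℚ < p → ∃ λ k → 1ℚ ≤ ℕ→ℚ k * p
  archimedean p@(mkℚ (ℤ.+ suc a) b-1 _) _ = suc b-1 , toℚᵘ-cancel-≤ (begin
    ℚᵘ.1ℚᵘ                                      ≤⟨ ℚᵘ.*≤* (subst₂ ℤ._≤_ (sym (ℤ.*-identityˡ _)) (sym (ℤ.*-identityʳ _))
      (ℤ.+≤+ (subst (ℕ._≤ suc b-1 ℕ.* suc a) (sym (ℕ.+-identityʳ _)) (ℕ.m≤m*n (suc b-1) (suc a))))) ⟩
    ℚᵘ.mkℚᵘ (ℤ.+ suc b-1) 0 ℚᵘ.* toℚᵘ p           ≃⟨ ℚᵘ.*-congʳ {toℚᵘ p}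
      (ℚᵘ.≃-sym (toℚᵘ-fromℚᵘ (ℚᵘ.mkℚᵘ (ℤ.+ suc b-1) 0))) ⟩
    toℚᵘ (ℕ→ℚ (suc b-1)) ℚᵘ.* toℚᵘ p          ≃⟨ ℚᵘ.≃-sym (toℚᵘ-homo-* (ℕ→ℚ (suc b-1)) p) ⟩
    toℚᵘ (ℕ→ℚ (suc b-1) * p)                  ∎)
    where open ℚᵘ.≤-Reasoning
  archimedean (mkℚ (ℤ.+ 0) _ _) (ℚ.*<* (ℤ.+<+ ()))
  archimedean (mkℚ (ℤ.-[1+ _ ]) _ _) (ℚ.*<* ())

  sumOver : List B → (B → ℚ) → ℚ
  sumOver l f = foldr _+_ 0ℚ (map f l)

  -- The default `0ℚ` keeps the factor nonnegative, and `average-def` covers the empty list because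
  -- the sum is zero there.
  1/length : List B → ℚ
  1/length []         = 0ℚ
  1/length l@(_ ∷ _) = ℤ.+ 1 ℚ./ length l

  1/length-pos : {l : List B} {z : B} → z ∈ l → 0ℚ < 1/length l
  1/length-pos {l = l@(_ ∷ xs)} _ = positive⁻¹ _ {{normalize-pos 1 (suc (length xs))}}

  1/length-nonNeg : (l : List B) → 0ℚ ≤ 1/length l
  1/length-nonNeg []         = ≤-refl
  1/length-nonNeg l@(_ ∷ _) = <⇒≤ (1/length-pos {l = l} (here refl))

  average : List B → (B → ℚ) → ℚ
  average l f = mean (map f l)

  average-def : ∀ l (f : B → ℚ) → average l f ≡ sumOver l f * 1/length l
  average-def []       f = refl
  average-def (z ∷ zs) f =
    cong (λ k → sumOver (z ∷ zs) f * (ℤ.+ 1 ℚ./ suc k)) (length-map f zs)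

  average-cong : ∀ l {f g : B → ℚ} → (∀ z → f z ≡ g z) → average l f ≡ average l g
  average-cong l f≗g = cong mean (map-cong f≗g l)

  sumOver-const : ∀ (l : List B) q → sumOver l (const q) ≡ ℕ→ℚ (length l) * q
  sumOver-const []      q = sym (*-zeroˡ q)
  sumOver-const (_ ∷ l) q = begin
    q + sumOver l (const q)     ≡⟨ cong (q +_) (sumOver-const l q) ⟩
    q + ℕ→ℚ (length l) * q    ≡⟨ solve 2 (λ q m → q :+ m :* q := (con 1ℚ :+ m) :* q) refl q (ℕ→ℚ (length l)) ⟩
    (1ℚ + ℕ→ℚ (length l)) * q ≡⟨ cong (_* q) (sym (ℕ→ℚ-suc (length l))) ⟩
    ℕ→ℚ (suc (length l)) * q  ∎
    where open ≡-Reasoning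

  average-const : ∀ {l : List B} {z} → z ∈ l → ∀ q → average l (const q) ≡ q
  average-const {l = l@(_ ∷ xs)} _ q = begin
    average l (const q)                    ≡⟨ average-def l (const q) ⟩
    sumOver l (const q) * 1/length l       ≡⟨ cong (_* 1/length l) (sumOver-const l q) ⟩
    ℕ→ℚ (length l) * q * 1/length l      ≡⟨ solve 3 (λ m q i → (m :* q) :* i := (m :* i) :* q) refl
      (ℕ→ℚ (length l)) q (1/length l) ⟩
    ℕ→ℚ (length l) * 1/length l * q      ≡⟨ cong (_* q) (ℕ→ℚ-inverse (length xs)) ⟩
    1ℚ * q                                 ≡⟨ *-identityˡ q ⟩
    q                                      ∎
    where open ≡-Reasoning

  sumOver-+ : ∀ l (f g : B → ℚ) → sumOver l (λ z → f z + g z) ≡ sumOver l f + sumOver l g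
  sumOver-+ []      f g = refl
  sumOver-+ (z ∷ l) f g = trans (cong (f z + g z +_) (sumOver-+ l f g))
    (solve 4 (λ a b c d → (a :+ b) :+ (c :+ d) := (a :+ c) :+ (b :+ d)) refl (f z) (g z) (sumOver l f) (sumOver l g))

  average-+ : ∀ l (f g : B → ℚ) → average l (λ z → f z + g z) ≡ average l f + average l g
  average-+ l f g = begin
    average l (λ z → f z + g z)                       ≡⟨ average-def l _ ⟩
    sumOver l (λ z → f z + g z) * 1/length l          ≡⟨ cong (_* 1/length l) (sumOver-+ l f g) ⟩
    (sumOver l f + sumOver l g) * 1/length l          ≡⟨ *-distribʳ-+ (1/length l) (sumOver l f) (sumOver l g) ⟩
    sumOver l f * 1/length l + sumOver l g * 1/length l ≡⟨ sym (cong₂ _+_ (average-def l f) (average-def l g)) ⟩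
    average l f + average l g ∎
    where open ≡-Reasoning

  sumOver-mono : ∀ l {f g : B → ℚ} → (∀ {z} → z ∈ l → f z ≤ g z) → sumOver l f ≤ sumOver l g
  sumOver-mono []      f≤g = ≤-refl
  sumOver-mono (z ∷ l) f≤g = +-mono-≤ (f≤g (here refl)) (sumOver-mono l (λ m → f≤g (there m)))

  sumOver-gap : ∀ {l : List B} {f g : B → ℚ} {z} → (∀ {z} → z ∈ l → f z ≤ g z) → z ∈ l → f z + δ ≤ g z →
                sumOver l f + δ ≤ sumOver l g
  sumOver-gap {δ = δ} {l = x ∷ l} {f} {g} f≤g (here refl) gap =
    linear (+-mono-≤ gap (sumOver-mono l (λ m → f≤g (there m))))
      (solve 5 (λ a b c d e → ((a :+ b) :+ c) :+ (d :+ e) := (d :+ e) :+ ((a :+ c) :+ b)) refl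
        (f x) (sumOver l f) δ (g x) (sumOver l g))
  sumOver-gap {δ = δ} {l = x ∷ l} {f} {g} f≤g (there z∈l) gap =
    linear (+-mono-≤ (f≤g (here refl)) (sumOver-gap (λ m → f≤g (there m)) z∈l gap))
      (solve 5 (λ a b c d e → ((a :+ b) :+ c) :+ (d :+ e) := (d :+ e) :+ (a :+ (b :+ c))) refl
        (f x) (sumOver l f) δ (g x) (sumOver l g))

  average-mono : ∀ l {f g : B → ℚ} → (∀ {z} → z ∈ l → f z ≤ g z) → average l f ≤ average l g
  average-mono l {f} {g} f≤g = subst₂ _≤_ (sym (average-def l f)) (sym (average-def l g))
    (*-monoʳ (1/length-nonNeg l) (sumOver-mono l f≤g))

  -- A quantitative form of strict monotonicity: a gap at one entry survives averaging, scaled by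
  -- the weight of that entry.
  average-gap : ∀ {l : List B} {f g : B → ℚ} {z} → (∀ {z} → z ∈ l → f z ≤ g z) → z ∈ l → f z + δ ≤ g z →
                average l f + 1/length l * δ ≤ average l g
  average-gap {δ = δ} {l = l} {f} {g} f≤g z∈l gap = begin
    average l f + 1/length l * δ             ≡⟨ cong (_+ 1/length l * δ) (average-def l f) ⟩
    sumOver l f * 1/length l + 1/length l * δ ≡⟨ solve 3 (λ s i d → s :* i :+ i :* d := (s :+ d) :* i) refl
      (sumOver l f) (1/length l) δ ⟩
    (sumOver l f + δ) * 1/length l           ≤⟨ *-monoʳ (1/length-nonNeg l) (sumOver-gap f≤g z∈l gap) ⟩
    sumOver l g * 1/length l                 ≡⟨ sym (average-def l g) ⟩
    average l g                              ∎
    where open ≤-Reasoning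

  𝟙 : Dec A → ℚ
  𝟙 A? = if does A? then 1ℚ else 0ℚ

  𝟙-yes : (A? : Dec A) → A → 𝟙 A? ≡ 1ℚ
  𝟙-yes (yes _) _ = refl
  𝟙-yes (no ¬a) a = ⊥-elim (¬a a)

  𝟙-no : (A? : Dec A) → ¬ A → 𝟙 A? ≡ 0ℚ
  𝟙-no (yes a) ¬a = ⊥-elim (¬a a)
  𝟙-no (no _)  _  = refl

  𝟙-mono : (A? : Dec A) (B? : Dec B) → (A → B) → 𝟙 A? ≤ 𝟙 B?
  𝟙-mono (yes a) B?      A→B = ≤-reflexive (sym (𝟙-yes B? (A→B a)))
  𝟙-mono (no _)  (yes _) _   = nonNegative⁻¹ 1ℚ
  𝟙-mono (no _)  (no _)  _   = ≤-refl

  module Walks {n : ℕ} (G : SimpleDigraph n) (out : ∀ u → ∃ (Edge G u)) where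

    private variable
      k j : ℕ

    open Tours G using (Walk)

    endpoint : Fin n → Vec (Fin n) k → Fin n
    endpoint u []       = u
    endpoint u (x ∷ xs) = endpoint x xs

    -- For `Walk u xs`, the probability that the random walk from `u` begins with the steps `xs`.
    weight : Fin n → Vec (Fin n) k → ℚ
    weight u []       = 1ℚ
    weight u (x ∷ xs) = 1/length (outNeighbours G u) * weight x xs

    Edge⇒∈ : ∀ {u x} → Edge G u x → x ∈ outNeighbours G u
    Edge⇒∈ {u} e = ∈-filter⁺ (edge? G u) (∈-allFin _) e

    ∈⇒Edge : ∀ {u x} → x ∈ outNeighbours G u → Edge G u x
    ∈⇒Edge {u} x∈ = proj₂ (∈-filter⁻ (edge? G u) {xs = allFin n} x∈)

    weight-pos : ∀ u (xs : Vec (Fin n) k) → Walk u xs → 0ℚ < weight u xs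
    weight-pos u []       _       = positive⁻¹ 1ℚ
    weight-pos u (x ∷ xs) (e , w) = *-pos (1/length-pos (Edge⇒∈ e)) (weight-pos x xs w)

    𝔼 : Fin n → (k : ℕ) → (Vec (Fin n) k → ℚ) → ℚ
    𝔼 u zero    f = f []
    𝔼 u (suc k) f = average (outNeighbours G u) (λ x → 𝔼 x k (λ xs → f (x ∷ xs)))

    walkProb≡𝔼 : ∀ u k {A : Pred (Vec (Fin n) k) _} (A? : Decidable A) →
                 walkProb G u k A? ≡ 𝔼 u k (λ xs → 𝟙 (A? xs))
    walkProb≡𝔼 u zero    A? = refl
    walkProb≡𝔼 u (suc k) A? =
      average-cong (outNeighbours G u) (λ x → walkProb≡𝔼 x k (λ xs → A? (x ∷ xs)))

    𝔼-cong : ∀ u k {f g : Vec (Fin n) k → ℚ} → (∀ xs → f xs ≡ g xs) → 𝔼 u k f ≡ 𝔼 u k g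
    𝔼-cong u zero    f≗g = f≗g []
    𝔼-cong u (suc k) f≗g = average-cong (outNeighbours G u) (λ x → 𝔼-cong x k (f≗g ∘ (x ∷_)))

    𝔼-const : ∀ u k q → 𝔼 u k (const q) ≡ q
    𝔼-const u zero    q = refl
    𝔼-const u (suc k) q =
      trans (average-cong (outNeighbours G u) (λ x → 𝔼-const x k q)) (average-const (Edge⇒∈ (proj₂ (out u))) q)

    𝔼-+ : ∀ u k (f g : Vec (Fin n) k → ℚ) → 𝔼 u k (λ xs → f xs + g xs) ≡ 𝔼 u k f + 𝔼 u k g
    𝔼-+ u zero    f g = refl
    𝔼-+ u (suc k) f g =
      trans (average-cong (outNeighbours G u) (λ x → 𝔼-+ x k (f ∘ (x ∷_)) (g ∘ (x ∷_))))
            (average-+ (outNeighbours G u) _ _)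

    𝔼-sum : ∀ u k {m} (f : Fin m → Vec (Fin n) k → ℚ) →
            sum (λ i → 𝔼 u k (f i)) ≡ 𝔼 u k (λ xs → sum (λ i → f i xs))
    𝔼-sum u k {zero}  f = sym (𝔼-const u k 0ℚ)
    𝔼-sum u k {suc m} f = trans (cong (𝔼 u k (f zero) +_) (𝔼-sum u k (f ∘ suc))) (sym (𝔼-+ u k (f zero) _))

    -- The comparison is asked only along walks of `G`; this is where facts about possible and
    -- impossible walks enter the probabilities.
    𝔼-mono : ∀ u k {f g : Vec (Fin n) k → ℚ} → (∀ xs → Walk u xs → f xs ≤ g xs) → 𝔼 u k f ≤ 𝔼 u k g
    𝔼-mono u zero    f≤g = f≤g [] tt
    𝔼-mono u (suc k) f≤g = average-mono (outNeighbours G u)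
      (λ {x} x∈ → 𝔼-mono x k (λ xs w → f≤g (x ∷ xs) (∈⇒Edge x∈ , w)))

    -- Iterates `average-gap` along `xs`: the factors collected at its steps multiply to the
    -- probability of this prefix.
    𝔼-gap : ∀ {u k j} {f g : Vec (Fin n) (k ℕ.+ j) → ℚ} (xs : Vec (Fin n) k) → Walk u xs →
            (∀ zs → Walk u zs → f zs ≤ g zs) → (∀ ys → f (xs ++ ys) + δ ≤ g (xs ++ ys)) →
            𝔼 u (k ℕ.+ j) f + weight u xs * δ ≤ 𝔼 u (k ℕ.+ j) g
    𝔼-gap {δ = δ} {u} {_} {j} {f} {g} [] _ f≤g gap = begin
      𝔼 u j f + 1ℚ * δ                ≡⟨ cong (𝔼 u j f +_) (trans (*-identityˡ δ) (sym (𝔼-const u j δ))) ⟩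
      𝔼 u j f + 𝔼 u j (const δ)       ≡⟨ sym (𝔼-+ u j f (const δ)) ⟩
      𝔼 u j (λ ys → f ys + δ)         ≤⟨ 𝔼-mono u j (λ ys _ → gap ys) ⟩
      𝔼 u j g                         ∎
      where open ≤-Reasoning
    𝔼-gap {δ = δ} {u} {suc k} {j} {f} {g} (x ∷ xs) (e , w) f≤g gap =
      subst (_≤ 𝔼 u (suc k ℕ.+ j) g)
        (cong (𝔼 u (suc k ℕ.+ j) f +_) (sym (*-assoc (1/length (outNeighbours G u)) (weight x xs) δ)))
        (average-gap (λ {z} z∈ → 𝔼-mono z (k ℕ.+ j) (λ zs w′ → f≤g (z ∷ zs) (∈⇒Edge z∈ , w′)))
          (Edge⇒∈ e)
          (𝔼-gap xs w (λ zs w′ → f≤g (x ∷ zs) (e , w′)) gap))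

    -- The Markov property at the fixed time `k`.
    𝔼-++ : ∀ u k j (f : Vec (Fin n) (k ℕ.+ j) → ℚ) →
           𝔼 u (k ℕ.+ j) f ≡ 𝔼 u k (λ xs → 𝔼 (endpoint u xs) j (λ ys → f (xs ++ ys)))
    𝔼-++ u zero    j f = refl
    𝔼-++ u (suc k) j f = average-cong (outNeighbours G u) (λ x → 𝔼-++ x k j (f ∘ (x ∷_)))

  -- Over a finite index set, take the least `δ` and the largest `N`.
  uniform : ∀ {n} {P : Fin n → ℚ → ℕ → Set} →
            (∀ {i δ δ′ N N′} → δ′ ≤ δ → N ℕ.≤ N′ → P i δ N → P i δ′ N′) →
            (∀ i → ∃₂ λ δ N → 0ℚ < δ × P i δ N) → ∃₂ λ δ N → 0ℚ < δ × ∀ i → P i δ N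
  uniform {zero}  weaken each = 1ℚ , 0 , positive⁻¹ 1ℚ , λ ()
  uniform {suc n} weaken each with each zero | uniform weaken (each ∘ suc)
  ... | δ , N , 0<δ , p | δ′ , N′ , 0<δ′ , ps =
    δ ℚ.⊓ δ′ , N ℕ.⊔ N′ , min-pos (≤-total δ δ′) ,
    λ { zero    → weaken (p⊓q≤p δ δ′) (ℕ.m≤m⊔n N N′) p
      ; (suc i) → weaken (p⊓q≤q δ δ′) (ℕ.m≤n⊔m N N′) (ps i) }
    where
    min-pos : δ ≤ δ′ ⊎ δ′ ≤ δ → 0ℚ < δ ℚ.⊓ δ′
    min-pos (inj₁ δ≤δ′) = subst (0ℚ <_) (sym (p≤q⇒p⊓q≡p δ≤δ′)) 0<δ
    min-pos (inj₂ δ′≤δ) = subst (0ℚ <_) (sym (p≥q⇒p⊓q≡q δ′≤δ)) 0<δ′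

  eventually : ∀ {n} {P : Fin n → ℕ → Set} → (∀ i → ∃ λ N → ∀ k → N ℕ.≤ k → P i k) →
               ∃ λ N → ∀ k → N ℕ.≤ k → ∀ i → P i k
  eventually {P = P} each =
    let _ , N , _ , p = uniform {P = λ i _ N → ∀ k → N ℕ.≤ k → P i k} (λ _ N≤ p k → p k ∘ ℕ.≤-trans N≤)
                          (λ i → let N , p = each i in 1ℚ , N , positive⁻¹ 1ℚ , p)
    in N , λ k N≤k i → p i k N≤k

  sum-≤ : ∀ {k} {f : Fin k → ℚ} {a} → (∀ i → f i ≤ a) → sum f ≤ ℕ→ℚ k * a
  sum-≤ {zero}      {a = a} f≤a = ≤-reflexive (sym (*-zeroˡ a))
  sum-≤ {suc k} {f} {a}     f≤a = begin
    f zero + sum (f ∘ suc)      ≤⟨ +-mono-≤ (f≤a zero) (sum-≤ (f≤a ∘ suc)) ⟩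
    a + ℕ→ℚ k * a               ≡⟨ solve 2 (λ q m → q :+ m :* q := (con 1ℚ :+ m) :* q) refl a (ℕ→ℚ k) ⟩
    (1ℚ + ℕ→ℚ k) * a            ≡⟨ cong (_* a) (ℕ→ℚ-suc k) ⟨
    ℕ→ℚ (suc k) * a             ∎
    where open ≤-Reasoning

  ≤-sum : ∀ {k} {f : Fin k → ℚ} {a} → (∀ i → a ≤ f i) → ℕ→ℚ k * a ≤ sum f
  ≤-sum {zero}      {a = a} a≤f = ≤-reflexive (*-zeroˡ a)
  ≤-sum {suc k} {f} {a}     a≤f = begin
    ℕ→ℚ (suc k) * a             ≡⟨ cong (_* a) (ℕ→ℚ-suc k) ⟩
    (1ℚ + ℕ→ℚ k) * a            ≡⟨ solve 2 (λ q m → q :+ m :* q := (con 1ℚ :+ m) :* q) refl a (ℕ→ℚ k) ⟨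
    a + ℕ→ℚ k * a               ≤⟨ +-mono-≤ (a≤f zero) (≤-sum (a≤f ∘ suc)) ⟩
    f zero + sum (f ∘ suc)      ∎
    where open ≤-Reasoning

  sum-𝟙 : ∀ {k} {A : Fin (suc k) → Set} (A? : ∀ i → Dec (A i)) i → A i → (∀ j → A j → i ≡ j) →
          sum (𝟙 ∘ A?) ≡ 1ℚ
  sum-𝟙 {k} A? i Ai unique = begin
    sum (𝟙 ∘ A?)                                    ≡⟨ sum-remove {i = i} (𝟙 ∘ A?) ⟩
    𝟙 (A? i) + sum (λ j → 𝟙 (A? (punchIn i j)))     ≡⟨ cong₂ _+_ (𝟙-yes (A? i) Ai)
      (sum-cong-≗ (λ j → 𝟙-no (A? (punchIn i j)) (λ Aj → punchInᵢ≢i i j (sym (unique _ Aj))))) ⟩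
    1ℚ + sum {k} (const 0ℚ)                         ≡⟨ cong (1ℚ +_) (sum-replicate-zero k) ⟩
    1ℚ                                              ∎
    where open ≡-Reasoning

  p≤∣p∣ : ∀ p → p ≤ ℚ.∣ p ∣
  p≤∣p∣ p with ≤-total 0ℚ p
  ... | inj₁ 0≤p = ≤-reflexive (sym (0≤p⇒∣p∣≡p 0≤p))
  ... | inj₂ p≤0 = ≤-trans p≤0 (0≤∣p∣ p)

  ≤-move : ∀ {a s t} → a + t ≤ s → a ≤ s + - t
  ≤-move {a} {s} {t} le = linear le (solve 3 (λ a s t → a :+ s := (s :+ :- t) :+ (a :+ t)) refl a s t)

  bound-drop : ∀ s t j η → s + j * η ≤ 1ℚ → η ≤ t → s + - t + (1ℚ + j) * η ≤ 1ℚ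
  bound-drop s t j η le η≤t = linear (+-mono-≤ le η≤t)
    (solve 4 (λ s t j e → ((s :+ :- t) :+ (con 1ℚ :+ j) :* e) :+ (con 1ℚ :+ t) := con 1ℚ :+ ((s :+ j :* e) :+ e))
      refl s t j η)

  s+t≤1⇒s≤0 : ∀ s t → s + t ≤ 1ℚ → 1ℚ ≤ t → s ≤ 0ℚ
  s+t≤1⇒s≤0 s t le 1≤t = linear (+-mono-≤ le 1≤t)
    (solve 2 (λ s t → s :+ (con 1ℚ :+ t) := con 0ℚ :+ ((s :+ t) :+ con 1ℚ)) refl s t)

  p≤p+q : ∀ p {q} → 0ℚ ≤ q → p ≤ p + q
  p≤p+q p {q} 0≤q = subst (_≤ p + q) (+-identityʳ p) (+-monoʳ-≤ p 0≤q)

  p≤q+r⇒p-r≤q : ∀ p q r → p ≤ q + r → p + - r ≤ q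
  p≤q+r⇒p-r≤q p q r le = linear le (solve 3 (λ a b e → (a :+ :- e) :+ (b :+ e) := b :+ a) refl p q r)

  ∣p-q∣<r⇒p≤q+r : ∀ p q {r} → ℚ.∣ p ℚ.- q ∣ < r → p ≤ q + r
  ∣p-q∣<r⇒p≤q+r p q {r} near = linear (<⇒≤ (≤-<-trans (p≤∣p∣ (p ℚ.- q)) near))
    (solve 3 (λ a b e → a :+ e := (b :+ e) :+ (a :+ :- b)) refl p q r)

  upper-bound : ∀ a c ε → 0ℚ ≤ ε → a + - ε ≤ c → a ≤ c + (ε + ε)
  upper-bound a c ε 0≤ε le = linear (+-mono-≤ le 0≤ε)
    (solve 3 (λ a c e → a :+ (c :+ e) := (c :+ (e :+ e)) :+ ((a :+ :- e) :+ con 0ℚ)) refl a c ε)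

  gap-bound : ∀ c a z ε → c ≤ a + ε → a ≤ z + ε → c ≤ z + (ε + ε)
  gap-bound c a z ε le₁ le₂ = linear (+-mono-≤ le₁ le₂)
    (solve 4 (λ c a z e → c :+ ((a :+ e) :+ (z :+ e)) := (z :+ (e :+ e)) :+ (c :+ a)) refl c a z ε)

  excess-bound : ∀ c γ ε → c + - ε + γ ≤ c + ε → γ ≤ ε + ε
  excess-bound c γ ε le = linear le
    (solve 3 (λ c g e → g :+ (c :+ e) := (e :+ e) :+ ((c :+ :- e) :+ g)) refl c γ ε)

  deficit-bound : ∀ a γ c ε → a + γ ≤ c + ε → c ≤ a + ε → γ ≤ ε + ε
  deficit-bound a γ c ε le₁ le₂ = linear (+-mono-≤ le₁ le₂)
    (solve 4 (λ a g c e → g :+ ((c :+ e) :+ (a :+ e)) := (e :+ e) :+ ((a :+ g) :+ c)) refl a γ c ε)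

  no-gap : ∀ {γ} → 0ℚ < γ → ¬ (∀ ε → 0ℚ < ε → γ ≤ ε + ε)
  no-gap {γ} 0<γ small with halve 0<γ
  ... | η , 0<η , refl with halve 0<η
  ...   | ε , 0<ε , refl = <-irrefl refl (<-≤-trans 0<η (linear (small ε 0<ε) (sym (+-identityˡ _))))

  -- Limits of the cover tour probabilities

  module CoverTours {m : ℕ} (G : SimpleDigraph (suc (suc m))) (connected : StronglyConnected G)
    (equalLast : (u v w : Fin (suc (suc m))) → u ≢ v → u ≢ w → v ≢ w → ℙL G u v ≈ ℙL G u w) where

    open Tours G

    V = Fin (suc (suc m))

    other : (u : V) → ∃ (u ≢_)
    other u = punchIn u zero , λ u≡ → punchInᵢ≢i u zero (sym u≡)

    out : (u : V) → ∃ (Edge G u)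
    out u with other u
    ... | v , u≢v with connected u v
    ...   | Star.ε = ⊥-elim (u≢v refl)
    ...   | e ◅ _ = _ , e

    open Walks G out

    starts-at-last : ∀ {k v} (X : Vec V k) → ¬ Sweep v v (v ∷ X)
    starts-at-last {v = v} X (t , _ , early , before) =
      let w , v≢w = other v ; s , s<t , _ = before w (v≢w ∘ sym , v≢w ∘ sym)
      in proj₁ (early zero (ℕ.≤-<-trans ℕ.z≤n s<t)) refl

    ℙL≡𝔼 : ∀ u v k → ℙL G u v k ≡ 𝔼 u k (λ xs → 𝟙 (tourEndsAt? v (u ∷ xs)))
    ℙL≡𝔼 u v k = walkProb≡𝔼 u k (λ xs → tourEndsAt? v (u ∷ xs))

    ℙL-self : ∀ u k → ℙL G u u k ≡ 0ℚ
    ℙL-self u k = begin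
      ℙL G u u k ≡⟨ ℙL≡𝔼 u u k ⟩
      𝔼 u k (λ xs → 𝟙 (tourEndsAt? u (u ∷ xs))) ≡⟨ 𝔼-cong u k
        (λ xs → 𝟙-no (tourEndsAt? u (u ∷ xs)) (starts-at-last xs ∘ endsAt⇒sweep (u ∷ xs))) ⟩
      𝔼 u k (const 0ℚ) ≡⟨ 𝔼-const u k 0ℚ ⟩
      0ℚ ∎
      where open ≡-Reasoning

    uncovered : V → ℕ → ℚ
    uncovered u k = 𝔼 u k (λ xs → 𝟙 (¬? (covers? (u ∷ xs))))

    ends-or-uncovered : ∀ {k} (X : Vec V (suc k)) → sum (λ v → 𝟙 (tourEndsAt? v X)) + 𝟙 (¬? (covers? X)) ≡ 1ℚ
    ends-or-uncovered X = split (covers? X)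
      where
      split : (c : Dec (Covers X)) → sum (λ v → 𝟙 (tourEndsAt? v X)) + 𝟙 (¬? c) ≡ 1ℚ
      split (yes cov) = let v , ends = covers⇒endsAt X cov in
        trans (+-identityʳ _) (sum-𝟙 (λ v → tourEndsAt? v X) v ends
          (λ w ends′ → sweep-unique X (endsAt⇒sweep X ends) (endsAt⇒sweep X ends′)))
      split (no ¬cov) = cong (_+ 1ℚ)
        (trans (sum-cong-≗ (λ v → 𝟙-no (tourEndsAt? v X) (¬cov ∘ sweep⇒covers X ∘ endsAt⇒sweep X)))
               (sum-replicate-zero (suc (suc m))))

    -- At every finite horizon the tour has either ended at exactly one vertex or is unfinished. It
    -- never ends at `u`, which leaves `suc m` possible last vertices.
    total-probability : ∀ u k → sum (λ i → ℙL G u (punchIn u i) k) + uncovered u k ≡ 1ℚ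
    total-probability u k = begin
      sum (λ i → ℙL G u (punchIn u i) k) + uncovered u k
        ≡⟨ cong (_+ uncovered u k) (+-identityˡ (sum (λ i → ℙL G u (punchIn u i) k))) ⟨
      0ℚ + sum (λ i → ℙL G u (punchIn u i) k) + uncovered u k
        ≡⟨ cong (λ q → q + sum (λ i → ℙL G u (punchIn u i) k) + uncovered u k) (sym (ℙL-self u k)) ⟩
      ℙL G u u k + sum (λ i → ℙL G u (punchIn u i) k) + uncovered u k
        ≡⟨ cong (_+ uncovered u k) (sym (sum-remove {i = u} (λ v → ℙL G u v k))) ⟩
      sum (λ v → ℙL G u v k) + uncovered u k
        ≡⟨ cong (_+ uncovered u k) (sum-cong-≗ (λ v → ℙL≡𝔼 u v k)) ⟩
      sum (λ v → 𝔼 u k (λ xs → 𝟙 (tourEndsAt? v (u ∷ xs)))) + uncovered u k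
        ≡⟨ cong (_+ uncovered u k) (𝔼-sum u k (λ v xs → 𝟙 (tourEndsAt? v (u ∷ xs)))) ⟩
      𝔼 u k (λ xs → sum (λ v → 𝟙 (tourEndsAt? v (u ∷ xs)))) + uncovered u k
        ≡⟨ sym (𝔼-+ u k _ _) ⟩
      𝔼 u k (λ xs → sum (λ v → 𝟙 (tourEndsAt? v (u ∷ xs))) + 𝟙 (¬? (covers? (u ∷ xs))))
        ≡⟨ 𝔼-cong u k (λ xs → ends-or-uncovered (u ∷ xs)) ⟩
      𝔼 u k (const 1ℚ) ≡⟨ 𝔼-const u k 1ℚ ⟩
      1ℚ ∎
      where open ≡-Reasoning

    uncovered-nonNeg : ∀ u k → 0ℚ ≤ uncovered u k
    uncovered-nonNeg u k = subst (_≤ uncovered u k) (𝔼-const u k 0ℚ)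
      (𝔼-mono u k (λ xs _ → 𝟙-mono (no id) (¬? (covers? (u ∷ xs))) ⊥-elim))

    uncovered-≤1 : ∀ u k → uncovered u k ≤ 1ℚ
    uncovered-≤1 u k = subst (uncovered u k ≤_) (𝔼-const u k 1ℚ)
      (𝔼-mono u k (λ xs _ → 𝟙-mono (¬? (covers? (u ∷ xs))) (yes tt) (const tt)))

    CoveringWalk : V → Set
    CoveringWalk u = ∃₂ λ k (xs : Vec V k) → Walk u xs × Covers (u ∷ xs)

    coveringWalk : ∀ u → CoveringWalk u
    coveringWalk u =
      -- No vertex is forbidden here, and the final hit of `target`, an out-neighbour of `u`, only
      -- serves to fit the shape of `exhaustive-tour`.
      let s , l , _ , all∈ , tour = exhaustive-tour {Anywhere} {target} {u} (λ _ → yes tt) tt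
                                      (λ a b _ _ → inj₁ (free (connected a b)))
                                      (λ z _ → tour-star (free (connected z u)) (tour-stop tt (proj₂ (out u))))
          k , xs , w , _ , _ , _ , before = tour⇒visits all∈ (tour-star (free (connected u s)) tour)
      in k , xs , w , λ z → let r , _ , eq = before z tt in r , eq
      where
      Anywhere : Pred V _
      Anywhere _ = ⊤
      target = proj₁ (out u)
      free : ∀ {a b} → Star (Edge G) a b → Star (Restrict Anywhere) a b
      free = Star.map (λ e → e , tt , tt)

    covers-restart : ∀ {k j} u (xs : Vec V k) {ys : Vec V j} → Covers (endpoint u xs ∷ ys) → Covers (u ∷ xs ++ ys)
    covers-restart u []       cov   = cov
    covers-restart u (x ∷ xs) cov w = let s , eq = covers-restart x xs cov w in suc s , eq

    -- A round of `K` steps multiplies a common bound `s` on the failure probabilities by `1 - δ`,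
    -- written without subtraction.
    Contracts : V → ℚ → ℕ → Set
    Contracts u δ K = ∀ k s → 0ℚ ≤ s → (∀ z → uncovered z k ≤ s) → uncovered u (K ℕ.+ k) + δ * s ≤ s

    -- With probability `weight u xs` the walk follows a covering walk and cannot fail. Otherwise
    -- restart at the current endpoint and forget the vertices seen so far, which can only raise the
    -- failure probability. All larger `K′` are included so that one round length can serve every
    -- start.
    contracts : ∀ u → ∃₂ λ δ K → 0ℚ < δ × (∀ K′ → K ℕ.≤ K′ → Contracts u δ K′)
    contracts u with coveringWalk u
    ... | K , xs , w , cov = weight u xs , K , weight-pos u xs w , λ K′ K≤K′ →
      subst (Contracts u (weight u xs)) (ℕ.m+[n∸m]≡n K≤K′) (contract (K′ ℕ.∸ K))
      where
      contract : ∀ j → Contracts u (weight u xs) (K ℕ.+ j)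
      contract j k s 0≤s bound = begin
        uncovered u (K ℕ.+ j ℕ.+ k) + weight u xs * s
          ≡⟨ cong (_+ weight u xs * s) (𝔼-++ u (K ℕ.+ j) k _) ⟩
        𝔼 u (K ℕ.+ j) rest + weight u xs * s
          ≤⟨ 𝔼-gap xs w (λ zs _ → rest≤s zs) (λ ys → ≤-trans (+-monoˡ-≤ s (rest≤0 ys)) (≤-reflexive (+-identityˡ s))) ⟩
        𝔼 u (K ℕ.+ j) (const s)
          ≡⟨ 𝔼-const u (K ℕ.+ j) s ⟩
        s ∎
        where
        open ≤-Reasoning
        rest : Vec V (K ℕ.+ j) → ℚ
        rest zs = 𝔼 (endpoint u zs) k (λ ys → 𝟙 (¬? (covers? (u ∷ zs ++ ys))))
        rest≤s : ∀ zs → rest zs ≤ s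
        rest≤s zs = ≤-trans (𝔼-mono (endpoint u zs) k (λ ys _ →
          𝟙-mono (¬? (covers? (u ∷ zs ++ ys))) (¬? (covers? (endpoint u zs ∷ ys)))
            (λ ¬cov → ¬cov ∘ covers-restart u zs)))
          (bound (endpoint u zs))
        rest≤0 : ∀ ys → rest (xs ++ ys) ≤ 0ℚ
        rest≤0 ys = ≤-reflexive (trans (𝔼-cong z k (λ zs →
          𝟙-no (¬? (covers? (u ∷ (xs ++ ys) ++ zs)))
            (λ ¬cov → ¬cov (covers-++ (u ∷ (xs ++ ys)) (covers-++ (u ∷ xs) cov)))))
          (𝔼-const z k 0ℚ))
          where z = endpoint u (xs ++ ys)

    Bound : ℚ → ℕ → Set
    Bound s N = ∀ k → N ℕ.≤ k → ∀ u → uncovered u k ≤ s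

    bound-step : ∀ {δ K s N} → (∀ u → Contracts u δ K) → 0ℚ ≤ s → Bound s N → Bound (s + - (δ * s)) (K ℕ.+ N)
    bound-step {δ} {K} {s} {N} contract 0≤s bound k K+N≤k u =
      subst (λ k′ → uncovered u k′ ≤ s + - (δ * s)) (ℕ.m+[n∸m]≡n (ℕ.m+n≤o⇒m≤o K K+N≤k))
        (≤-move {uncovered u (K ℕ.+ (k ℕ.∸ K))} {s} {δ * s} (contract u (k ℕ.∸ K) s 0≤s (bound (k ℕ.∸ K)
          (ℕ.m+n≤o⇒m≤o∸n N (subst (ℕ._≤ k) (ℕ.+-comm K N) K+N≤k)))))

    -- As long as the bound exceeds ε it drops by at least δ * ε every K steps.
    bound-iterate : ∀ {δ K ε} → 0ℚ < δ → 0ℚ < ε → (∀ u → Contracts u δ K) →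
                    ∀ j → ∃₂ λ s N → Bound s N × (s ≤ ε ⊎ s + ℕ→ℚ j * (δ * ε) ≤ 1ℚ)
    bound-iterate {δ} {ε = ε} _ _ _ zero =
      1ℚ , 0 , (λ k _ u → uncovered-≤1 u k) , inj₂ (≤-reflexive (cong (1ℚ +_) (*-zeroˡ (δ * ε))))
    bound-iterate {δ} {K} {ε} 0<δ 0<ε contract (suc j) = next (bound-iterate {δ} {K} {ε} 0<δ 0<ε contract j)
      where
      next : (∃₂ λ s N → Bound s N × (s ≤ ε ⊎ s + ℕ→ℚ j * (δ * ε) ≤ 1ℚ)) →
             ∃₂ λ s N → Bound s N × (s ≤ ε ⊎ s + ℕ→ℚ (suc j) * (δ * ε) ≤ 1ℚ)
      next (s , N , bound , inj₁ s≤ε) = s , N , bound , inj₁ s≤ε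
      next (s , N , bound , inj₂ progress) = Sum.[
          (λ s≤ε → s , N , bound , inj₁ s≤ε) ,
          (λ ε≤s → s + - (δ * s) , K ℕ.+ N , bound-step {δ} {K} {s} {N} contract (≤-trans (<⇒≤ 0<ε) ε≤s) bound ,
                   inj₂ (subst (λ t → s + - (δ * s) + t * (δ * ε) ≤ 1ℚ) (sym (ℕ→ℚ-suc j))
                          (bound-drop s (δ * s) (ℕ→ℚ j) (δ * ε) progress (*-monoˡ (<⇒≤ 0<δ) ε≤s)))) ]
        (≤-total s ε)

    Contracts-weaken : ∀ {u δ δ′ K} → δ′ ≤ δ → Contracts u δ K → Contracts u δ′ K
    Contracts-weaken {u} {K = K} δ′≤δ contract k s 0≤s bound =
      ≤-trans (+-monoʳ-≤ (uncovered u (K ℕ.+ k)) (*-monoʳ 0≤s δ′≤δ)) (contract k s 0≤s bound)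

    uniformly-contracts : ∃₂ λ δ K → 0ℚ < δ × ∀ u K′ → K ℕ.≤ K′ → Contracts u δ K′
    uniformly-contracts = uniform {P = λ u δ K → ∀ K′ → K ℕ.≤ K′ → Contracts u δ K′}
      (λ {u} {δ} {δ′} δ′≤δ N≤N′ contract K′ N′≤K′ →
        Contracts-weaken {u} {δ} {δ′} {K′} δ′≤δ (contract K′ (ℕ.≤-trans N≤N′ N′≤K′)))
      contracts

    uncovered-vanishes : ∀ ε → 0ℚ < ε → ∃ λ N → Bound ε N
    uncovered-vanishes ε 0<ε = from uniformly-contracts
      where
      finish : ∀ η J → 1ℚ ≤ ℕ→ℚ J * η → (∃₂ λ s N → Bound s N × (s ≤ ε ⊎ s + ℕ→ℚ J * η ≤ 1ℚ)) → ∃ λ N → Bound ε N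
      finish η J 1≤Jη (s , N , bound , progress) = N , λ k N≤k u → ≤-trans (bound k N≤k u)
        (Sum.[ id , (λ ≤1 → ≤-trans (s+t≤1⇒s≤0 s (ℕ→ℚ J * η) ≤1 1≤Jη) (<⇒≤ 0<ε)) ] progress)
      from : (∃₂ λ δ K → 0ℚ < δ × ∀ u K′ → K ℕ.≤ K′ → Contracts u δ K′) → ∃ λ N → Bound ε N
      from (δ , K , 0<δ , contract) =
        -- After `J` drops of at least `δ * ε` the initial bound 1 is used up, so both alternatives
        -- of `bound-iterate` give a bound of at most `ε`.
        let J , 1≤Jη = archimedean (δ * ε) (*-pos 0<δ 0<ε)
        in finish (δ * ε) J 1≤Jη (bound-iterate {δ} {K} {ε} 0<δ 0<ε (λ u → contract u K ℕ.≤-refl) J)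

    c : ℚ
    c = ℤ.+ 1 ℚ./ suc m

    c-pos : 0ℚ < c
    c-pos = positive⁻¹ c {{normalize-pos 1 (suc m)}}

    ℕ→ℚ-cancel : ∀ {p q} → ℕ→ℚ (suc m) * p ≤ q → p ≤ c * q
    ℕ→ℚ-cancel {p} {q} Mp≤q = begin
      p                       ≡⟨ *-identityˡ p ⟨
      1ℚ * p                  ≡⟨ cong (_* p) (ℕ→ℚ-inverse m) ⟨
      ℕ→ℚ (suc m) * c * p     ≡⟨ solve 3 (λ M c p → (M :* c) :* p := c :* (M :* p)) refl (ℕ→ℚ (suc m)) c p ⟩
      c * (ℕ→ℚ (suc m) * p)   ≤⟨ *-monoˡ (<⇒≤ c-pos) Mp≤q ⟩
      c * q                   ∎
      where open ≤-Reasoning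

    c-cancel : ∀ {p} → 1ℚ ≤ ℕ→ℚ (suc m) * p → c ≤ p
    c-cancel {p} 1≤Mp = begin
      c                       ≡⟨ *-identityʳ c ⟨
      c * 1ℚ                  ≤⟨ *-monoˡ (<⇒≤ c-pos) 1≤Mp ⟩
      c * (ℕ→ℚ (suc m) * p)   ≡⟨ solve 3 (λ M c p → c :* (M :* p) := (M :* c) :* p) refl (ℕ→ℚ (suc m)) c p ⟩
      ℕ→ℚ (suc m) * c * p     ≡⟨ cong (_* p) (ℕ→ℚ-inverse m) ⟩
      1ℚ * p                  ≡⟨ *-identityˡ p ⟩
      p                       ∎
      where open ≤-Reasoning

    M-pos : 0ℚ < ℕ→ℚ (suc m)
    M-pos = positive⁻¹ _ {{normalize-pos (suc m) 1}}

    equalise : ∀ ε → 0ℚ < ε → ∃ λ N → ∀ k → N ℕ.≤ k → ∀ u v w → u ≢ v → u ≢ w → ℙL G u v k ≤ ℙL G u w k + ε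
    equalise ε 0<ε = eventually λ u → eventually λ v → eventually (close u v)
      where
      close : ∀ u v w → ∃ λ N → ∀ k → N ℕ.≤ k → u ≢ v → u ≢ w → ℙL G u v k ≤ ℙL G u w k + ε
      close u v w = go (v ≟ w) (u ≟ v) (u ≟ w)
        where
        Close : Set
        Close = ∃ λ N → ∀ k → N ℕ.≤ k → u ≢ v → u ≢ w → ℙL G u v k ≤ ℙL G u w k + ε
        go : Dec (v ≡ w) → Dec (u ≡ v) → Dec (u ≡ w) → Close
        go (yes refl) _         _         = 0 , λ k _ _ _ → p≤p+q (ℙL G u v k) (<⇒≤ 0<ε)
        go (no _)     (yes u≡v) _         = 0 , λ k _ u≢v → ⊥-elim (u≢v u≡v)
        go (no _)     (no _)    (yes u≡w) = 0 , λ k _ _ u≢w → ⊥-elim (u≢w u≡w)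
        go (no v≢w)   (no u≢v)  (no u≢w)  = let N , near = equalLast u v w u≢v u≢w v≢w ε 0<ε in
          N , λ k N≤k _ _ → ∣p-q∣<r⇒p≤q+r (ℙL G u v k) (ℙL G u w k) (near k N≤k)

    Near : ℚ → ℕ → Set
    Near ε k = ∀ u v → u ≢ v → ℙL G u v k ≤ c + ε × c ≤ ℙL G u v k + ε

    -- The `suc m` probabilities for tours from `u` differ by at most `ε`, and their sum is 1 up to
    -- `uncovered u k`; compare this sum with `suc m` copies of `ℙL G u v k`. The tolerance for
    -- `uncovered` carries the factor `suc m` so that division leaves a single `ε`.
    near-limit : ∀ ε k → 0ℚ ≤ ε → (∀ u v w → u ≢ v → u ≢ w → ℙL G u v k ≤ ℙL G u w k + ε) →
                 (∀ u → uncovered u k ≤ ℕ→ℚ (suc m) * ε) → Near (ε + ε) k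
    near-limit ε k 0≤ε equal small u v u≢v =
      upper-bound (ℙL G u v k) c ε 0≤ε
        (subst (ℙL G u v k + - ε ≤_) (*-identityʳ c) (ℕ→ℚ-cancel (≤-trans (≤-sum below) ≤1))) ,
      c-cancel (begin
        1ℚ                                  ≡⟨ total-probability u k ⟨
        sum f + uncovered u k               ≤⟨ +-mono-≤
          (sum-≤ (λ i → equal u (punchIn u i) v (u≢punchIn i) u≢v)) (small u) ⟩
        M * (ℙL G u v k + ε) + M * ε        ≡⟨ *-distribˡ-+ M (ℙL G u v k + ε) ε ⟨
        M * (ℙL G u v k + ε + ε)            ≡⟨ cong (M *_) (+-assoc (ℙL G u v k) ε ε) ⟩
        M * (ℙL G u v k + (ε + ε))          ∎)
      where
      open ≤-Reasoning
      M = ℕ→ℚ (suc m)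
      f : Fin (suc m) → ℚ
      f i = ℙL G u (punchIn u i) k
      u≢punchIn : ∀ i → u ≢ punchIn u i
      u≢punchIn i eq = punchInᵢ≢i u i (sym eq)
      below : ∀ i → ℙL G u v k + - ε ≤ f i
      below i = p≤q+r⇒p-r≤q (ℙL G u v k) (f i) ε (equal u v (punchIn u i) u≢v (u≢punchIn i))
      ≤1 : sum f ≤ 1ℚ
      ≤1 = subst (sum f ≤_) (total-probability u k) (p≤p+q (sum f) (uncovered-nonNeg u k))

    limit : ∀ ε → 0ℚ < ε → ∃ λ N → ∀ k → N ℕ.≤ k → Near ε k
    limit ε 0<ε = from (halve 0<ε)
      where
      from : (∃ λ η → 0ℚ < η × η + η ≡ ε) → ∃ λ N → ∀ k → N ℕ.≤ k → Near ε k
      from (η , 0<η , η+η≡ε) =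
        let N₁ , equal  = equalise η 0<η
            N₂ , vanish = uncovered-vanishes (ℕ→ℚ (suc m) * η) (*-pos M-pos 0<η)
        in N₁ ℕ.⊔ N₂ , λ k N≤k → subst (λ ε → Near ε k) η+η≡ε
             (near-limit η k (<⇒≤ 0<η) (equal k (ℕ.m⊔n≤o⇒m≤o N₁ N₂ N≤k)) (vanish k (ℕ.m⊔n≤o⇒n≤o N₁ N₂ N≤k)))

    -- Otherwise `ℙL G u v k` would vanish for all `k`, whereas it tends to `c > 0`. The walk is
    -- thereby obtained only in doubly negated form.
    sweep-possible : ∀ {u v} → u ≢ v → ¬ (∀ {k} (xs : Vec V k) → Walk u xs → ¬ Sweep v v (u ∷ xs))
    sweep-possible {u} {v} u≢v impossible = no-gap c-pos small
      where
      zero-probability : ∀ k → ℙL G u v k ≤ 0ℚ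
      zero-probability k = subst₂ _≤_ (sym (ℙL≡𝔼 u v k)) (𝔼-const u k 0ℚ)
        (𝔼-mono u k (λ xs w → 𝟙-mono (tourEndsAt? v (u ∷ xs)) (no id) (impossible xs w ∘ endsAt⇒sweep (u ∷ xs))))
      small : ∀ ε → 0ℚ < ε → c ≤ ε + ε
      small ε 0<ε = let N , near = limit ε 0<ε in
        subst (c ≤_) (+-identityˡ (ε + ε)) (gap-bound c (ℙL G u v N) 0ℚ ε (proj₂ (near N ℕ.≤-refl u v u≢v))
          (≤-trans (zero-probability N) (≤-trans (<⇒≤ 0<ε) (≤-reflexive (sym (+-identityˡ ε))))))

    -- For `u ≢ v`, the term ℙ(L(x,v)) + ℙ(D(x)) of the first-step average, at a finite horizon.
    ℙL-via : V → V → ℕ → V → ℚ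
    ℙL-via u v k x = 𝔼 x k (λ xs → 𝟙 (tourEndsAt? v (u ∷ x ∷ xs)))

    ℙL-step : ∀ u v k → ℙL G u v (suc k) ≡ average (outNeighbours G u) (ℙL-via u v k)
    ℙL-step u v k = ℙL≡𝔼 u v (suc k)

    ℙL≤ℙL-via : ∀ {u v} k x → u ≢ v → ℙL G x v k ≤ ℙL-via u v k x
    ℙL≤ℙL-via {u} {v} k x u≢v = subst (_≤ ℙL-via u v k x) (sym (ℙL≡𝔼 x v k))
      (𝔼-mono x k (λ xs _ → 𝟙-mono (tourEndsAt? v (x ∷ xs)) (tourEndsAt? v (u ∷ x ∷ xs))
        (sweep⇒endsAt (u ∷ x ∷ xs) ∘ sweep-∷ (x ∷ xs) u≢v ∘ endsAt⇒sweep (x ∷ xs))))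

    -- Every out-neighbour `z` of `u` differs from `v`, so each term of the first-step average is at
    -- least ℙ(L(z,v)), which tends to `c`. A possible detour would lift the limit of the average
    -- above `c` by at least `γ`.
    nonedge⇒no-detour : ∀ {u v x k} → u ≢ v → ¬ Edge G u v → Edge G u x →
                        (xs : Vec V k) → Walk x xs → ¬ Sweep u v (x ∷ xs)
    nonedge⇒no-detour {u} {v} {x} {k} u≢v ¬uv ux xs w detour =
      no-gap {γ} (*-pos (1/length-pos (Edge⇒∈ ux)) (*-pos (weight-pos x xs w) (positive⁻¹ 1ℚ))) small
      where
      γ : ℚ
      -- The probability of stepping to `x` and then following `xs`; the last factor is the jump of
      -- the indicator from 0 to 1 on these trajectories.
      γ = 1/length (outNeighbours G u) * (weight x xs * 1ℚ)

      gain : ∀ j → ℙL G x v (k ℕ.+ j) + weight x xs * 1ℚ ≤ ℙL-via u v (k ℕ.+ j) x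
      gain j = subst (λ q → q + weight x xs * 1ℚ ≤ ℙL-via u v (k ℕ.+ j) x) (sym (ℙL≡𝔼 x v (k ℕ.+ j)))
        (𝔼-gap {g = λ zs → 𝟙 (tourEndsAt? v (u ∷ x ∷ zs))} xs w
          (λ zs _ → 𝟙-mono (tourEndsAt? v (x ∷ zs)) (tourEndsAt? v (u ∷ x ∷ zs))
            (sweep⇒endsAt (u ∷ x ∷ zs) ∘ sweep-∷ (x ∷ zs) u≢v ∘ endsAt⇒sweep (x ∷ zs)))
          (λ ys → let d = visits-++ {P = Off u v} {Off u v} (x ∷ xs) {ys} detour in ≤-reflexive (trans
            (cong (_+ 1ℚ) (𝟙-no (tourEndsAt? v (x ∷ xs ++ ys))
              (detour-excludes (x ∷ xs ++ ys) u≢v d ∘ endsAt⇒sweep (x ∷ xs ++ ys))))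
            (trans (+-identityˡ 1ℚ) (sym (𝟙-yes (tourEndsAt? v (u ∷ x ∷ xs ++ ys))
              (sweep⇒endsAt (u ∷ x ∷ xs ++ ys) (sweep-detour (x ∷ xs ++ ys) u≢v d))))))))

      step : ∀ ε j → Near ε (k ℕ.+ j) → c + - ε + γ ≤ ℙL G u v (suc (k ℕ.+ j))
      step ε j near = subst₂ (λ p q → p + γ ≤ q) (average-const (Edge⇒∈ ux) (c + - ε)) (sym (ℙL-step u v (k ℕ.+ j)))
        (average-gap {f = λ _ → c + - ε} {g = ℙL-via u v (k ℕ.+ j)}
          (λ {z} z∈ → ≤-trans (low z (∈⇒Edge z∈)) (ℙL≤ℙL-via (k ℕ.+ j) z u≢v))
          (Edge⇒∈ ux)
          (≤-trans (+-monoˡ-≤ (weight x xs * 1ℚ) (low x ux)) (gain j)))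
        where
        low : ∀ z → Edge G u z → c + - ε ≤ ℙL G z v (k ℕ.+ j)
        low z uz = p≤q+r⇒p-r≤q c (ℙL G z v (k ℕ.+ j)) ε (proj₂ (near z v (λ { refl → ¬uv uz })))

      small : ∀ ε → 0ℚ < ε → γ ≤ ε + ε
      small ε 0<ε = let N , near = limit ε 0<ε in
        excess-bound c γ ε (≤-trans (step ε N (near (k ℕ.+ N) (ℕ.m≤n+m N k)))
          (proj₁ (near (suc (k ℕ.+ N)) (ℕ.m≤n⇒m≤1+n (ℕ.m≤n+m N k)) u v u≢v)))

    -- Without detours the term of the out-neighbour `v` is zero, since no tour from `v` ends at
    -- `v`, and the other terms are at most about `c`. The average would then fall short of `c` by
    -- its share `γ`.
    edge⇒detour : ∀ {u v} → u ≢ v → Edge G u v →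
                  ¬ (∀ {x k} → Edge G u x → (xs : Vec V k) → Walk x xs → ¬ Sweep u v (x ∷ xs))
    edge⇒detour {u} {v} u≢v uv no-detour = no-gap {γ} (*-pos (1/length-pos (Edge⇒∈ uv)) c-pos) small
      where
      γ : ℚ
      γ = 1/length (outNeighbours G u) * c

      ℙL-via-start : ∀ k → ℙL-via u v k v ≤ 0ℚ
      ℙL-via-start k = subst (ℙL-via u v k v ≤_) (𝔼-const v k 0ℚ)
        (𝔼-mono v k (λ xs w → 𝟙-mono (tourEndsAt? v (u ∷ v ∷ xs)) (no id) λ ends →
          Sum.[ starts-at-last xs , no-detour uv xs w ] (sweep-uncons (v ∷ xs) u≢v (endsAt⇒sweep (u ∷ v ∷ xs) ends))))

      ℙL-via≤ : ∀ k x → Edge G u x → ℙL-via u v k x ≤ ℙL G x v k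
      ℙL-via≤ k x ux = subst (ℙL-via u v k x ≤_) (sym (ℙL≡𝔼 x v k))
        (𝔼-mono x k (λ xs w → 𝟙-mono (tourEndsAt? v (u ∷ x ∷ xs)) (tourEndsAt? v (x ∷ xs)) λ ends →
          sweep⇒endsAt (x ∷ xs) (Sum.[ id , (λ detour → ⊥-elim (no-detour ux xs w detour)) ]
            (sweep-uncons (x ∷ xs) u≢v (endsAt⇒sweep (u ∷ x ∷ xs) ends)))))

      step : ∀ ε k → 0ℚ ≤ ε → Near ε k → ℙL G u v (suc k) + γ ≤ c + ε
      step ε k 0≤ε near = subst₂ (λ p q → p + γ ≤ q) (sym (ℙL-step u v k)) (average-const (Edge⇒∈ uv) (c + ε))
        (average-gap {f = ℙL-via u v k} {g = λ _ → c + ε} (λ {z} z∈ → high z (∈⇒Edge z∈) (z ≟ v)) (Edge⇒∈ uv)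
          (≤-trans (+-monoˡ-≤ c (ℙL-via-start k)) (≤-trans (≤-reflexive (+-identityˡ c)) (p≤p+q c 0≤ε))))
        where
        high : ∀ z → Edge G u z → Dec (z ≡ v) → ℙL-via u v k z ≤ c + ε
        high z uz (yes refl) = ≤-trans (ℙL-via-start k) (≤-trans (<⇒≤ c-pos) (p≤p+q c 0≤ε))
        high z uz (no z≢v)   = ≤-trans (ℙL-via≤ k z uz) (proj₁ (near z v z≢v))

      small : ∀ ε → 0ℚ < ε → γ ≤ ε + ε
      small ε 0<ε = let N , near = limit ε 0<ε in
        deficit-bound (ℙL G u v (suc N)) γ c ε
          (step ε N (<⇒≤ 0<ε) (near N ℕ.≤-refl)) (proj₂ (near (suc N) (ℕ.n≤1+n N) u v u≢v))

-- Vertex deletion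

¬¬-∀ : ∀ {n} {P : Pred (Fin n) 0ℓ} → (∀ i → ¬ ¬ P i) → ¬ ¬ (∀ i → P i)
¬¬-∀ = sequence (RawMonad.rawApplicative ¬¬-Monad)

module Deletion {n : ℕ} (G : SimpleDigraph n) where

  open Tours G

  -- G − {u, v}; G − u is Del u u.
  Del : Fin n → Fin n → Rel (Fin n) 0ℓ
  Del u v = Restrict (Off u v)

  -- Reachability is decided by a hypothetical oracle, available under double negation by
  -- `¬¬-decides`. This suffices because it is discharged only in proofs of absurdity or of
  -- decidable statements about edges.
  Decides : Set
  Decides = ∀ u v a b → Dec (Star (Del u v) a b)

  ¬¬-decides : ¬ ¬ Decides
  ¬¬-decides = ¬¬-∀ λ u → ¬¬-∀ λ v → ¬¬-∀ λ a → ¬¬-∀ λ b → ¬¬-excluded-middle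

  Biconnected : Set
  Biconnected = ∀ v a b → a ≢ v → b ≢ v → Star (Del v v) a b

  Unilateral : Fin n → Fin n → Set
  Unilateral u v = ∀ a b → Off u v a → Off u v b → Star (Del u v) a b ⊎ Star (Del u v) b a

  del-swap : ∀ {u v a b} → Star (Del u v) a b → Star (Del v u) a b
  del-swap = Star.map λ (e , offa , offb) → e , swap offa , swap offb

  unilateral-swap : ∀ {u v} → Unilateral u v → Unilateral v u
  unilateral-swap total a b offa offb = Sum.map del-swap del-swap (total a b (swap offa) (swap offb))

  -- Cut the path at its last visit to `u`, if there is one.
  enter : ∀ {u v a s} → Star (Del v v) a s → Off u v s →
          Star (Del u v) a s ⊎ ∃ λ x → Edge G u x × Star (Del u v) x s
  enter Star.ε _ = inj₁ Star.ε
  enter {u} {a = a} ((e , (a≢v , _) , (y≢v , _)) ◅ st) offs with enter {u} st offs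
  ... | inj₂ found = inj₂ found
  ... | inj₁ st′ with a ≟ u
  ...   | yes refl = inj₂ (_ , e , st′)
  ...   | no a≢u = inj₁ ((e , (a≢u , a≢v) , start st′) ◅ st′)
    where
    start : ∀ {y} → Star (Del u _) y _ → Off u _ y
    start Star.ε           = offs
    start ((_ , off , _) ◅ _) = off

  -- Cut the path at its first arrival at `v`.
  leave : ∀ {u v z} → Star (Del u u) z v → Off u v z → ∃ λ c → Star (Del u v) z c × Off u v c × Edge G c v
  leave Star.ε (_ , z≢v) = ⊥-elim (z≢v refl)
  leave {v = v} (_◅_ {j = y} (e , _ , (y≢u , _)) st) offz with y ≟ v
  ... | yes refl = _ , Star.ε , offz , e
  ... | no y≢v = let c , st′ , offc , e′ = leave st (y≢u , y≢v) in c , (e , offz , y≢u , y≢v) ◅ st′ , offc , e′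

  exit-tour : ∀ {u v} → Biconnected → u ≢ v → ∀ z → Off u v z → Tour (Off u v) v [] z
  exit-tour {u} {v} biconnected u≢v z offz@(z≢u , _) =
    let c , st , offc , cv = leave (biconnected u z v z≢u (u≢v ∘ sym)) offz
    in tour-star {P = Off u v} st (tour-stop {P = Off u v} offc cv)

  -- Unilaterality gives a walk through all of `G − {u, v}` that then steps to `v`. A path from `u`
  -- to its first vertex `s` in `G − v`, cut at the last visit to `u`, supplies the out-neighbour
  -- `x`.
  unilateral⇒sweep : ∀ {u v} → Biconnected → StronglyConnected G → u ≢ v → ¬ Edge G u v → Unilateral u v →
                     ∃ λ x → Edge G u x × ∃₂ λ k (xs : Vec (Fin n) k) → Walk x xs × Sweep u v (x ∷ xs)
  unilateral⇒sweep {u} {v} biconnected connected u≢v ¬uv total with connected u v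
  ... | Star.ε = ⊥-elim (u≢v refl)
  ... | _◅_ {j = y} uy _
    with exhaustive-tour {Off u v} {v} {y} (off? u v)
           ((λ { refl → noLoop G refl uy }) , (λ { refl → ¬uv uy })) total (exit-tour biconnected u≢v)
  ...   | s , l , offs@(s≢u , s≢v) , all∈ , tour with enter {u} (biconnected v u s u≢v s≢v) offs
  ...     | inj₂ (x , ux , st) = x , ux , tour⇒visits {P = Off u v} all∈ (tour-star {P = Off u v} st tour)
  -- A path that starts at `u` cannot lie in `G − {u, v}`.
  ...     | inj₁ Star.ε = ⊥-elim (s≢u refl)
  ...     | inj₁ ((_ , (u≢u , _) , _) ◅ _) = ⊥-elim (u≢u refl)

  -- Both vertices are visited before `t`, and the stretch of the walk between the two visits stays
  -- in `G − {u, v}`.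
  sweep⇒unilateral : ∀ {u v x k} (xs : Vec (Fin n) k) → Walk x xs → Sweep u v (x ∷ xs) → Unilateral u v
  sweep⇒unilateral {u} {v} {x} xs w (t , _ , early , before) a b offa offb
    with before a offa | before b offb
  ... | r , r<t , refl | s , s<t , refl with ℕ.≤-total (Fin.toℕ r) (Fin.toℕ s)
  ...   | inj₁ r≤s = inj₁ (segment {P = Off u v} x xs w t early r s r≤s s<t)
  ...   | inj₂ s≤r = inj₂ (segment {P = Off u v} x xs w t early s r s≤r r<t)

  sweep⇒reaches : ∀ {v x k} (xs : Vec (Fin n) k) → Walk x xs → Sweep v v (x ∷ xs) → ∀ b → b ≢ v → Star (Del v v) x b
  sweep⇒reaches {v} {x} xs w (t , _ , early , before) b b≢v with before b (b≢v , b≢v)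
  ... | s , s<t , refl = segment {P = Off v v} x xs w t early zero s ℕ.z≤n s<t

  -- Separating pairs in the undirected case

  module Undirected (symmetric : ∀ {u v} → Edge G u v → Edge G v u) (decides : Decides) (biconnected : Biconnected)
    (disconnects : ∀ u v → u ≢ v → ¬ Edge G u v → ¬ (∀ a b → Off u v a → Off u v b → Star (Del u v) a b)) where

    reverse : ∀ {u v a b} → Star (Del u v) a b → Star (Del u v) b a
    reverse = Star.reverse λ (e , offa , offb) → symmetric e , offb , offa

    module _ {u v : Fin n} (u≢v : u ≢ v) (¬uv : ¬ Edge G u v) where

      private
        H  = Del u v
        OH = Off u v

      -- Follow the path until it first meets `u` or `v`. Before that it stays in the component of
      -- `w` in `G − {u, v}`, which does not contain `a`.
      escape : ∀ {a b z w} → Off a b u → Off a b v → Star (Del b b) w z → ¬ OH z → OH w → Off a b w → ¬ Star H w a →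
               Star (Del a b) w u ⊎ Star (Del a b) w v
      escape _ _ Star.ε ¬offz offz _ _ = ⊥-elim (¬offz offz)
      escape {a} {b} offu offv (_◅_ {j = y} (e , _ , (y≢b , _)) st) ¬offz offw off ¬wa with y ≟ u | y ≟ v
      ... | yes refl | _        = inj₁ ((e , off , offu) ◅ Star.ε)
      ... | no _     | yes refl = inj₂ ((e , off , offv) ◅ Star.ε)
      ... | no y≢u   | no y≢v   = Sum.map (step ◅_) (step ◅_)
              (escape offu offv st ¬offz (y≢u , y≢v) offy (λ ya → ¬wa (stepH ◅ ya)))
        where
        stepH : H _ y
        stepH = e , offw , y≢u , y≢v
        offy : Off a b y
        offy = (λ { refl → ¬wa (stepH ◅ Star.ε) }) , y≢b
        step : Del a b _ y
        step = e , off , offy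

      -- Otherwise G − {a, b} would be connected: after deleting a or b, each vertex still reaches u or v.
      separates : ∀ {a b} → OH a → OH b → ¬ Star H a b → ¬ Star (Del a b) u v
      separates {a} {b} offa@(a≢u , a≢v) offb@(b≢u , b≢v) ¬ab uv =
        disconnects a b (λ { refl → ¬ab Star.ε }) (λ e → ¬ab ((e , offa , offb) ◅ Star.ε))
          (λ c d offc offd → toU c offc ◅◅ reverse (toU d offd))
        where
        offu : Off a b u
        offu = a≢u ∘ sym , b≢u ∘ sym
        offv : Off a b v
        offv = a≢v ∘ sym , b≢v ∘ sym
        toU : ∀ w → Off a b w → Star (Del a b) w u
        toU w off@(w≢a , w≢b) with w ≟ u | w ≟ v | decides u v w b
        ... | yes refl | _        | _      = Star.ε
        ... | no _     | yes refl | _      = reverse uv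
        -- Here `w` lies in the component of `b`, hence not in that of `a`, so a path in `G − b`
        -- escapes while avoiding `a`. In the remaining case `w` is not joined to `b`, and `a` and
        -- `b` exchange roles.
        ... | no w≢u   | no w≢v   | yes wb = Sum.[ id , _◅◅ reverse uv ]
          (escape offu offv (biconnected b w u w≢b (b≢u ∘ sym)) (λ (u≢u , _) → u≢u refl) (w≢u , w≢v) off
            (λ wa → ¬ab (reverse wa ◅◅ wb)))
        ... | no w≢u   | no w≢v   | no ¬wb = Sum.[ del-swap , (λ wv → del-swap wv ◅◅ reverse uv) ]
          (escape (swap offu) (swap offv) (biconnected a w u w≢a (a≢u ∘ sym)) (λ (u≢u , _) → u≢u refl) (w≢u , w≢v)
            (swap off) ¬wb)

      -- Up to its first arrival at `v` the path stays in the component of `z` in `G − {u, v}`,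
      -- which contains neither `a` nor `b`.
      reach-v : ∀ {a b z} → Off a b v → Star (Del u u) z v → OH z → ¬ Star H z a → ¬ Star H z b → Star (Del a b) z v
      reach-v _ Star.ε (_ , v≢v) _ _ = ⊥-elim (v≢v refl)
      reach-v {a} {b} {z} offv (_◅_ {j = y} (e , _ , (y≢u , _)) st) offz ¬za ¬zb = go (y ≟ v)
        where
        off : Off a b z
        off = (λ { refl → ¬za Star.ε }) , (λ { refl → ¬zb Star.ε })
        go : Dec (y ≡ v) → Star (Del a b) z v
        go (yes refl) = (e , off , offv) ◅ Star.ε
        go (no y≢v) = (e , off , (λ { refl → ¬za (zy ◅ Star.ε) }) , (λ { refl → ¬zb (zy ◅ Star.ε) })) ◅
          reach-v offv st (y≢u , y≢v) (¬za ∘ (zy ◅_)) (¬zb ∘ (zy ◅_))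
          where
          zy : H z y
          zy = e , offz , y≢u , y≢v

      -- Follow a path to v from its last visit to {x, y}.
      last-of-two : ∀ {x y b z} → OH x → OH y → OH b → x ≢ y → Star (Del u u) z v → OH z → ¬ Star H z b →
                    (Off x y z × Star (Del x b) z v × Star (Del y b) z v) ⊎ Star (Del y b) x v ⊎ Star (Del x b) y v
      last-of-two _ _ _ _ Star.ε (_ , v≢v) _ = ⊥-elim (v≢v refl)
      last-of-two {x} {y} {b} {z} offx@(_ , x≢v) offy@(_ , y≢v) offb@(_ , b≢v) x≢y
                  (_◅_ {j = w} (e , _ , (w≢u , _)) st) offz ¬zb =
        prepend (w ≟ v)
        where
        z≢b : z ≢ b
        z≢b refl = ¬zb Star.ε
        Result : Set
        Result = (Off x y z × Star (Del x b) z v × Star (Del y b) z v) ⊎ Star (Del y b) x v ⊎ Star (Del x b) y v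
        at : Off y b w → Star (Del x b) w v → Star (Del y b) w v → Off x b w → Result
        at offyw xs ys offxw with z ≟ x | z ≟ y
        ... | yes refl | _        = inj₂ (inj₁ ((e , (x≢y , z≢b) , offyw) ◅ ys))
        ... | no _     | yes refl = inj₂ (inj₂ ((e , (x≢y ∘ sym , z≢b) , offxw) ◅ xs))
        ... | no z≢x   | no z≢y   = inj₁ ((z≢x , z≢y) , (e , (z≢x , z≢b) , offxw) ◅ xs , (e , (z≢y , z≢b) , offyw) ◅ ys)
        prepend : Dec (w ≡ v) → Result
        prepend (yes refl) = at (y≢v ∘ sym , b≢v ∘ sym) Star.ε Star.ε offxv
          where
          offxv : Off x b v
          offxv = x≢v ∘ sym , b≢v ∘ sym
        prepend (no w≢v) with last-of-two offx offy offb x≢y st (w≢u , w≢v) (λ wb → ¬zb ((e , offz , w≢u , w≢v) ◅ wb))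
        ... | inj₂ done = inj₂ done
        ... | inj₁ ((w≢x , w≢y) , xs , ys) = at (w≢y , w≢b) xs ys (w≢x , w≢b)
          where
          w≢b : w ≢ b
          w≢b refl = ¬zb ((e , offz , w≢u , w≢v) ◅ Star.ε)

      separated-pair : ∃₂ λ a b → OH a × OH b × ¬ Star H a b
      separated-pair with any? (λ a → any? λ b → off? u v a ×-dec off? u v b ×-dec ¬? (decides u v a b))
      ... | yes found = found
      ... | no none = ⊥-elim (disconnects u v u≢v ¬uv λ a b offa offb →
        decidable-stable (decides u v a b) λ ¬ab → none (a , b , offa , offb , ¬ab))

      -- In `G − {u, v}`, `x` cannot be joined to both members of a separated pair.
      separated-from : ∀ x → ∃ λ b → OH b × ¬ Star H x b
      separated-from x with separated-pair
      ... | a , b , offa , offb , ¬ab with decides u v x a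
      ...   | yes xa = b , offb , λ xb → ¬ab (reverse xa ◅◅ xb)
      ...   | no ¬xa = a , offa , ¬xa

      neighbour-off : ∀ {x} → Edge G u x → OH x
      neighbour-off ux = (λ { refl → noLoop G refl ux }) , λ { refl → ¬uv ux }

      -- Suppose `x` and `y` share a component and take `b` outside it. A path from `x` to `v` in
      -- `G − u`, followed from its last visit to one of `x` and `y`, avoids the other one and `b`.
      -- Prefixed with the edge from `u`, it contradicts `separates`.
      neighbours-separated : ∀ {x y} → Edge G u x → Edge G u y → x ≢ y → ¬ Star H x y
      neighbours-separated {x} {y} ux uy x≢y xy with separated-from x
      ... | b , offb@(b≢u , b≢v) , ¬xb =
        Sum.[ (λ ((x≢x , _) , _) → x≢x refl) ,
          Sum.[ (λ xv → separates offy offb (λ yb → ¬xb (xy ◅◅ yb)) ((ux , (y≢u ∘ sym , b≢u ∘ sym) , x≢y , x≢b) ◅ xv))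
              , (λ yv → separates offx offb ¬xb ((uy , (x≢u ∘ sym , b≢u ∘ sym) , x≢y ∘ sym , y≢b) ◅ yv)) ] ]
          (last-of-two offx offy offb x≢y (biconnected u x v x≢u (u≢v ∘ sym)) offx ¬xb)
        where
        offx = neighbour-off ux
        offy = neighbour-off uy
        x≢u = proj₁ offx
        y≢u = proj₁ offy
        x≢b : x ≢ b
        x≢b refl = ¬xb Star.ε
        y≢b : y ≢ b
        y≢b refl = ¬xb xy

      -- The separated neighbours `x` and `y` cut `u` off from `v`, yet a third neighbour `z`, in a
      -- component without `x` and `y`, still leads from `u` to `v`.
      two-neighbours : ∀ {x y z} → Edge G u x → Edge G u y → Edge G u z → x ≢ y → x ≢ z → y ≢ z → ⊥
      two-neighbours {x} {y} {z} ux uy uz x≢y x≢z y≢z = separates offx offy (neighbours-separated ux uy x≢y)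
        ((uz , (x≢u ∘ sym , y≢u ∘ sym) , x≢z ∘ sym , y≢z ∘ sym) ◅
         reach-v (x≢v ∘ sym , y≢v ∘ sym) (biconnected u z v (proj₁ offz) (u≢v ∘ sym)) offz
           (neighbours-separated uz ux (x≢z ∘ sym)) (neighbours-separated uz uy (y≢z ∘ sym)))
        where
        offx = neighbour-off ux
        offy = neighbour-off uy
        offz = neighbour-off uz
        x≢u = proj₁ offx
        x≢v = proj₂ offx
        y≢u = proj₁ offy
        y≢v = proj₂ offy

      -- Take the first step of a path from `u` to `v` in `G − w`.
      second-neighbour : ∀ {w} → Edge G u w → ∃ λ y → y ≢ w × Edge G u y
      second-neighbour {w} uw with biconnected w u v (λ { refl → noLoop G refl uw }) (λ { refl → ¬uv uw })
      ... | Star.ε = ⊥-elim (u≢v refl)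
      ... | (uy , _ , (y≢w , _)) ◅ _ = _ , y≢w , uy

      -- A vertex adjacent to all others would differ from `u` and `v` and would connect
      -- `G − {u, v}`. Hence the results about the neighbours of `u` apply at every vertex.
      nonneighbour : ∀ w → ∃ λ z → w ≢ z × ¬ Edge G w z
      nonneighbour w with any? (λ z → ¬? (w ≟ z) ×-dec ¬? (edge? G w z))
      ... | yes found = found
      ... | no none = ⊥-elim (disconnects u v u≢v ¬uv (λ a b offa offb → reverse (fromW a offa) ◅◅ fromW b offb))
        where
        adjacent : ∀ z → w ≢ z → Edge G w z
        adjacent z w≢z = decidable-stable (edge? G w z) λ ¬wz → none (z , w≢z , ¬wz)
        offw : OH w
        offw = (λ { refl → none (v , u≢v , ¬uv) }) , (λ { refl → none (u , u≢v ∘ sym , ¬uv ∘ symmetric) })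
        fromW : ∀ z → OH z → Star H w z
        fromW z offz with w ≟ z
        ... | yes refl = Star.ε
        ... | no w≢z = (adjacent z w≢z , offw , offz) ◅ Star.ε

-- Bidirected cycles

module Cycle {n : ℕ} (G : SimpleDigraph (suc n)) (connected : StronglyConnected G)
  (symmetric : ∀ {u v} → Edge G u v → Edge G v u)
  (two-neighbours : ∀ {u x y z} → Edge G u x → Edge G u y → Edge G u z → x ≢ y → x ≢ z → y ≢ z → ⊥)
  (second-neighbour : ∀ {u w} → Edge G u w → ∃ λ y → y ≢ w × Edge G u y)
  {a b : Fin (suc n)} (ab : Edge G a b) where

  -- A walk without backtracking: having entered `v` from `u`, it leaves by a neighbour of `v` other
  -- than `u`.
  arc : ℕ → ∃₂ (Edge G)
  arc zero    = a , b , ab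
  arc (suc k) = let u , v , uv = arc k ; w , _ , vw = second-neighbour (symmetric uv) in v , w , vw

  p : ℕ → Fin (suc n)
  p k = proj₁ (arc k)

  p-edge : ∀ k → Edge G (p k) (p (suc k))
  p-edge k = proj₂ (proj₂ (arc k))

  p-turn : ∀ k → p (suc (suc k)) ≢ p k
  p-turn k = proj₁ (proj₂ (second-neighbour (symmetric (p-edge k))))

  one-of-two : ∀ {u x y z} → Edge G u x → Edge G u y → x ≢ y → Edge G u z → z ≡ x ⊎ z ≡ y
  one-of-two {x = x} {y} {z} ux uy x≢y uz with z ≟ x | z ≟ y
  ... | yes z≡x | _       = inj₁ z≡x
  ... | no _    | yes z≡y = inj₂ z≡y
  ... | no z≢x  | no z≢y  = ⊥-elim (two-neighbours ux uy uz x≢y (z≢x ∘ sym) (z≢y ∘ sym))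

  p-neighbours : ∀ k {z} → Edge G (p (suc k)) z → z ≡ p (suc (suc k)) ⊎ z ≡ p k
  p-neighbours k = one-of-two (p-edge (suc k)) (symmetric (p-edge k)) (p-turn k)

  Distinct : ℕ → Set
  Distinct m = ∀ {i j} → i ℕ.< j → j ℕ.< m → p i ≢ p j

  distinct⇒injective : ∀ {m i j} → Distinct m → i ℕ.< m → j ℕ.< m → p i ≡ p j → i ≡ j
  distinct⇒injective {i = i} {j} distinct i<m j<m eq with ℕ.<-cmp i j
  ... | tri< i<j _ _ = ⊥-elim (distinct i<j j<m eq)
  ... | tri≈ _ i≡j _ = i≡j
  ... | tri> _ _ j<i = ⊥-elim (distinct j<i i<m (sym eq))

  -- The vertex before `p m` is adjacent to `p i`. If `i` were positive, it would be `p (i - 1)` or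
  -- `p (i + 1)`: the first contradicts distinctness, the second distinctness, `p-turn` or `noLoop`,
  -- according to its position.
  returns-to-start : ∀ {m i} → Distinct m → i ℕ.< m → p m ≡ p i → i ≡ 0
  returns-to-start {i = zero} _ _ _ = refl
  returns-to-start {suc m} {suc i} distinct (s≤s i<m) eq
    with p-neighbours i (subst (λ x → Edge G x (p m)) eq (symmetric (p-edge m)))
  ... | inj₂ eq′ = ⊥-elim (distinct i<m ℕ.≤-refl (sym eq′))
  ... | inj₁ eq′ with ℕ.<-cmp (suc (suc i)) m
  ...   | tri< 2+i<m _ _  = ⊥-elim (distinct 2+i<m ℕ.≤-refl (sym eq′))
  ...   | tri≈ _ refl _   = ⊥-elim (p-turn (suc i) eq)
  ...   | tri> _ _ (s≤s m≤1+i) with ℕ.≤-antisym m≤1+i i<m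
  ...     | refl = ⊥-elim (noLoop G eq′ (p-edge m))

  closes-late : ∀ {m} → 1 ℕ.≤ m → p m ≡ p 0 → 3 ℕ.≤ m
  closes-late {1} _ eq = ⊥-elim (noLoop G (sym eq) (p-edge 0))
  closes-late {2} _ eq = ⊥-elim (p-turn 0 eq)
  closes-late {suc (suc (suc m))} _ _ = s≤s (s≤s (s≤s z≤n))

  closed-neighbours : ∀ {m i z} → Distinct m → p m ≡ p 0 → i ℕ.< m → Edge G (p i) z →
                      z ≡ p (suc i) ⊎ ∃ λ h → h ℕ.< m × z ≡ p h × (i ≡ suc h ⊎ (suc h ≡ m × i ≡ 0))
  closed-neighbours {i = suc i} distinct closed i<m e with p-neighbours i e
  ... | inj₁ eq = inj₁ eq
  ... | inj₂ eq = inj₂ (i , ℕ.<-trans ℕ.≤-refl i<m , eq , inj₁ refl)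
  -- At index 0 the second neighbour is the last vertex before the walk closes; it differs from
  -- `p 1` because the cycle has length at least 3.
  closed-neighbours {suc m} {zero} distinct closed i<m e with closes-late (s≤s z≤n) closed
  ... | s≤s 2≤m with one-of-two (p-edge 0) (subst (λ x → Edge G x (p m)) closed (symmetric (p-edge m)))
                                (distinct 2≤m ℕ.≤-refl) e
  ...   | inj₁ eq = inj₁ eq
  ...   | inj₂ eq = inj₂ (m , ℕ.≤-refl , eq , inj₂ (refl , refl))

  -- The vertices of the closed walk form a set closed under adjacency, so strong connectedness
  -- makes it everything.
  exhausts : ∀ {m} → 1 ℕ.≤ m → Distinct m → p m ≡ p 0 → ∀ z → ∃ λ i → i ℕ.< m × p i ≡ z
  exhausts {m} 1≤m distinct closed z = follow (connected (p 0) z) (0 , 1≤m , refl)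
    where
    follow : ∀ {x y} → Star (Edge G) x y → (∃ λ i → i ℕ.< m × p i ≡ x) → ∃ λ i → i ℕ.< m × p i ≡ y
    follow Star.ε    found = found
    follow (e ◅ st) (i , i<m , refl) with closed-neighbours distinct closed i<m e
    ... | inj₂ (h , h<m , eq , _) = follow st (h , h<m , sym eq)
    ... | inj₁ eq with ℕ.m≤n⇒m<n∨m≡n i<m
    ...   | inj₁ 1+i<m = follow st (suc i , 1+i<m , sym eq)
    ...   | inj₂ refl  = follow st (0 , 1≤m , trans (sym closed) (sym eq))

  exhausts⇒≤ : ∀ {m} → (∀ z → ∃ λ i → i ℕ.< m × p i ≡ z) → suc n ℕ.≤ m
  exhausts⇒≤ {m} found = injective⇒≤ {f = λ z → fromℕ< (proj₁ (proj₂ (found z)))} λ {x} {y} eq →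
    trans (sym (proj₂ (proj₂ (found x))))
      (trans (cong p (fromℕ<-injective _ _ (proj₁ (proj₂ (found x))) (proj₁ (proj₂ (found y))) eq))
             (proj₂ (proj₂ (found y))))

  -- A first repetition closes a cycle that exhausts the graph, so it cannot occur before `suc n`
  -- vertices have been listed.
  distinct : ∀ m → suc m ℕ.≤ suc n → Distinct (suc m)
  distinct zero    _ {j = zero} () _
  distinct zero    _ {j = suc _} _ (s≤s ())
  distinct (suc m) m<n {i} {j} i<j (s≤s j≤m) eq with ℕ.m≤n⇒m<n∨m≡n j≤m
  ... | inj₁ j<m = distinct m (ℕ.<⇒≤ m<n) i<j j<m eq
  ... | inj₂ refl with returns-to-start (distinct m (ℕ.<⇒≤ m<n)) i<j (sym eq)
  ...   | refl = ℕ.<-irrefl refl (ℕ.<-≤-trans m<n (exhausts⇒≤ (exhausts (s≤s z≤n) (distinct m (ℕ.<⇒≤ m<n)) (sym eq))))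

  p-distinct : Distinct (suc n)
  p-distinct = distinct n ℕ.≤-refl

  p-injective : ∀ {i j} → i ℕ.< suc n → j ℕ.< suc n → p i ≡ p j → i ≡ j
  p-injective = distinct⇒injective p-distinct

  p-closed : p (suc n) ≡ p 0
  -- Among the `suc (suc n)` vertices from `p 0` to `p (suc n)` two coincide; by `p-distinct` the
  -- later one is `p (suc n)`.
  p-closed with pigeonhole {suc n} ℕ.≤-refl (p ∘ toℕ)
  ... | i , j , i<j , eq with ℕ.m≤n⇒m<n∨m≡n (ℕ.s≤s⁻¹ (toℕ<n j))
  ...   | inj₁ j<n = ⊥-elim (p-distinct i<j j<n eq)
  ...   | inj₂ j≡n = trans eq′ (cong p (returns-to-start p-distinct (subst (toℕ i ℕ.<_) j≡n i<j) eq′))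
    where
    eq′ : p (suc n) ≡ p (toℕ i)
    eq′ = trans (cong p (sym j≡n)) (sym eq)

  p-exhausts : ∀ z → ∃ λ i → i ℕ.< suc n × p i ≡ z
  p-exhausts = exhausts (s≤s z≤n) p-distinct p-closed

  p-% : ∀ {k} → k ℕ.< suc n → p (suc k % suc n) ≡ p (suc k)
  p-% {k} k<n with ℕ.m≤n⇒m<n∨m≡n k<n
  ... | inj₁ 1+k<n = cong p (m<n⇒m%n≡m 1+k<n)
  ... | inj₂ refl  = trans (cong p (n%n≡0 (suc n))) (sym p-closed)

  isBidirectedCycle : IsBidirectedCycle G
  isBidirectedCycle = closes-late (s≤s z≤n) p-closed , permutation (p ∘ toℕ) index p∘index index∘p ,
    λ i j → mk⇔ (edge⇒successor i j) Sum.[ successor⇒edge i j , symmetric ∘ successor⇒edge j i ]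
    where
    index : Fin (suc n) → Fin (suc n)
    index z = fromℕ< (proj₁ (proj₂ (p-exhausts z)))
    p∘index : ∀ z → p (toℕ (index z)) ≡ z
    p∘index z = let i , i<n , eq = p-exhausts z in trans (cong p (toℕ-fromℕ< i<n)) eq
    index∘p : ∀ i → index (p (toℕ i)) ≡ i
    index∘p i = toℕ-injective (p-injective {toℕ (index (p (toℕ i)))} (toℕ<n _) (toℕ<n i) (p∘index (p (toℕ i))))

    successor⇒edge : ∀ i j → CyclicSuccessor i j → Edge G (p (toℕ i)) (p (toℕ j))
    successor⇒edge i j succ = subst (Edge G (p (toℕ i))) (sym (trans (cong p succ) (p-% (toℕ<n i)))) (p-edge (toℕ i))

    edge⇒successor : ∀ i j → Edge G (p (toℕ i)) (p (toℕ j)) → CyclicSuccessor i j ⊎ CyclicSuccessor j i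
    edge⇒successor i j e with closed-neighbours p-distinct p-closed (toℕ<n i) e
    ... | inj₁ eq = inj₁ (p-injective (toℕ<n j) (m%n<n (suc (toℕ i)) (suc n)) (trans eq (sym (p-% (toℕ<n i)))))
    ... | inj₂ (h , h<n , eq , prev) with p-injective (toℕ<n j) h<n eq
    ...   | refl with prev
    ...     | inj₁ i≡1+j = inj₂ (trans (sym (m<n⇒m%n≡m (toℕ<n i))) (cong (_% suc n) i≡1+j))
    ...     | inj₂ (1+j≡n , i≡0) = inj₂ (trans i≡0 (sym (trans (cong (_% suc n) 1+j≡n) (n%n≡0 (suc n)))))

-- Noncomplete digraphs with equally likely last vertices

module Incomplete {m : ℕ} (G : SimpleDigraph (suc (suc m))) (connected : StronglyConnected G)
  (equalLast : (u v w : Fin (suc (suc m))) → u ≢ v → u ≢ w → v ≢ w → ℙL G u v ≈ ℙL G u w)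
  {u₀ v₀ : Fin (suc (suc m))} (u₀≢v₀ : u₀ ≢ v₀) (¬u₀v₀ : ¬ Edge G u₀ v₀) where

  open CoverTours G connected equalLast
  open Deletion G

  biconnected : Decides → Biconnected
  biconnected decides v a b a≢v b≢v = decidable-stable (decides v v a b) λ ¬ab →
    sweep-possible a≢v λ xs w sweep → ¬ab (sweep⇒reaches xs w sweep b b≢v)

  nonedge⇒¬unilateral : Decides → ∀ {u v} → u ≢ v → ¬ Edge G u v → ¬ Unilateral u v
  nonedge⇒¬unilateral decides u≢v ¬uv total =
    let x , ux , _ , xs , w , detour = unilateral⇒sweep (biconnected decides) connected u≢v ¬uv total
    in nonedge⇒no-detour u≢v ¬uv ux xs w detour

  -- A missing reverse edge forbids `Unilateral v u`, while the edge `uv` yields a detour and thus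
  -- `Unilateral u v`, which is the same condition. Decidability of edges absorbs the double
  -- negations.
  symmetric : ∀ {u v} → Edge G u v → Edge G v u
  symmetric {u} {v} uv = decidable-stable (edge? G v u) λ ¬vu → ¬¬-decides λ decides →
    edge⇒detour u≢v uv λ _ xs w detour → nonedge⇒¬unilateral decides (λ v≡u → u≢v (sym v≡u)) ¬vu
      (unilateral-swap (sweep⇒unilateral xs w detour))
    where
    u≢v : u ≢ v
    u≢v u≡v = noLoop G u≡v uv

  module _ (decides : Decides) where
    open Undirected symmetric decides (biconnected decides)
      (λ u v u≢v ¬uv all → nonedge⇒¬unilateral decides u≢v ¬uv λ a b offa offb → inj₁ (all a b offa offb)) public

  at-most-two : ∀ {u x y z} → Edge G u x → Edge G u y → Edge G u z → x ≢ y → x ≢ z → y ≢ z → ⊥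
  at-most-two {u} ux uy uz x≢y x≢z y≢z = ¬¬-decides λ decides →
    let _ , u≢v , ¬uv = nonneighbour decides u₀≢v₀ ¬u₀v₀ u
    in two-neighbours decides u≢v ¬uv ux uy uz x≢y x≢z y≢z

  at-least-two : ∀ {u w} → Edge G u w → ∃ λ y → y ≢ w × Edge G u y
  at-least-two {u} {w} uw = decidable-stable (any? λ y → ¬? (y ≟ w) ×-dec edge? G u y) λ none → ¬¬-decides λ decides →
    let _ , u≢v , ¬uv = nonneighbour decides u₀≢v₀ ¬u₀v₀ u
    in none (second-neighbour decides u≢v ¬uv uw)

  isCycle : IsBidirectedCycle G
  isCycle = Cycle.isBidirectedCycle G connected symmetric at-most-two at-least-two (proj₂ (out u₀))

mainTheorem2 : (n : ℕ) .{{_ : NonZero n}} (G : SimpleDigraph n) →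
    StronglyConnected G →
    ((u v w : Fin n) → u ≢ v → u ≢ w → v ≢ w → ℙL G u v ≈ ℙL G u w) →
    IsBidirectedCycle G ⊎ IsBidirectedComplete G
mainTheorem2 (suc n) G connected equalLast
  with any? (λ u → any? λ v → ¬? (u ≟ v) ×-dec ¬? (edge? G u v))
... | no none = inj₂ λ u v → mk⇔ (λ uv u≡v → noLoop G u≡v uv)
        (λ u≢v → decidable-stable (edge? G u v) λ ¬uv → none (u , v , u≢v , ¬uv))
mainTheorem2 (suc zero) G connected equalLast | yes (zero , zero , u≢v , _) = ⊥-elim (u≢v refl)
mainTheorem2 (suc (suc m)) G connected equalLast | yes (u , v , u≢v , ¬uv) =
  inj₁ (Incomplete.isCycle G connected equalLast u≢v ¬uv)
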